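{- The competitive ratio of any randomized algorithm for capacitated online $2$-recoloring is $\Omega(\log n)$, for an arbitrary amount of resource augmentation $\varepsilon>0$. That is, there are absolute constants $\kappa>0$ and $n_0$ such that for every $n\ge n_0$ and every $\varepsilon>0$ there is an instance with $n$ vertices (a choice of weights and of initial coloring) such that every randomized online algorithm $\mathcal A$ on it using capacity $(1+\varepsilon)B$ per color, where $B=\frac12\sum_{v}w(v)$, satisfies: if $\mathbb E[\mathcal A_\sigma]\le\alpha\,OPT_\sigma$ for every admissible request sequence $\sigma$, then $\alpha\ge\kappa\log n$.
   Context: Capacitated online $2$-recoloring. There is a fixed set $V$ of $n$ vertices with weights $w(v)$ which are positive integers, such that $\sum_{v\in V}w(v)$ is even and $w(v)\le B:=\frac12\sum_{u\in V}w(u)$ for every $v$. An initial coloring $c_0:V\to\{1,2\}$ is given in which each color class has total weight at most $B$. A finite sequence $\sigma=(\sigma_1,\dots,\sigma_T)$ of edges $\sigma_t=(u_t,v_t)$ between vertices of $V$ is revealed one at a time. Let $G_t$ be the graph on $V$ with edges $\sigma_1,\dots,\sigma_t$. The sequence is admissible if $G_T$ has a proper $2$-coloring in which each color class has total weight at most $B$. After each request $\sigma_t$ the algorithm must output a proper $2$-coloring $c_t$ of $G_t$, and the total weight of the vertices of each color must not exceed the algorithm's capacity at any time. Recoloring a vertex $v$ costs $w(v)$, so the total cost is $\sum_{t=1}^T\sum_{v:\,c_t(v)\ne c_{t-1}(v)}w(v)$. A deterministic online algorithm determines $c_t$ from $V,w,c_0$ and $\sigma_1,\dots,\sigma_t$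 only; a randomized online algorithm is a probability distribution over deterministic online algorithms, and the request sequence $\sigma$ is fixed independently of its random choices. $\mathcal A_\sigma$ denotes the (random) total cost of $\mathcal A$ on $\sigma$, where $\mathcal A$ has capacity $(1+\varepsilon)B$ per color ($(1+\varepsilon)$-resource augmentation; for $\varepsilon\ge1$ this is no constraint). $OPT_\sigma$ denotes the minimum total cost of an offline algorithm (which knows all of $\sigma$ in advance) that has capacity $B$ per color. -}

module Defs where

open import Algebra.Properties.CommutativeMonoid.Sum as Sums using ()
open import Data.Bool.Base using (Bool; true; false; not; T; if_then_else_)
open import Data.Fin.Base using (Fin; zero; suc)
open import Data.Fin.Properties using (_≟_)
open import Data.Integer.Base as ℤ using (ℤ; +_)
import Data.Integer.Properties as ℤ
open import Data.List.Base using (List; length; take)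
open import Data.List.Relation.Unary.All using (All)
open import Data.Nat.Base as ℕ using (ℕ; zero; suc; z≤n; s≤s; _⊔_)
open import Data.Nat.Divisibility using (_∣_)
open import Data.Nat.DivMod using (_/_)
open import Data.Nat.Induction using (<-rec)
open import Data.Nat.Logarithm
import Data.Nat.Properties as ℕ
open import Data.Product using (Σ; _×_; _,_; proj₁; proj₂; ∃; ∃-syntax)
open import Data.Rational.Base as ℚ using (ℚ; mkℚ; 0ℚ; 1ℚ; ½)
import Data.Rational.Properties as ℚ
open import Data.Rational.Solver using (module +-*-Solver)
import Data.Rational.Unnormalised.Base as ℚᵘ
import Data.Rational.Unnormalised.Properties as ℚᵘ
open import Data.Sum.Base using (inj₁; inj₂)
open import Function.Base using (_∘_)
open import Function.Bundles using (_⇔_)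
open import Relation.Binary.PropositionalEquality
  using (_≡_; _≢_; refl; sym; trans; cong; cong₂; subst; subst₂)
open import Relation.Nullary using (¬_; yes; no)
open import Relation.Nullary.Decidable using (⌊_⌋)

------------------------------------------------------------------------
-- Real numbers as Cauchy sequences of rationals.  Equality of reals is
-- "≤ both ways"; all operations act termwise.

IsCauchy : (ℕ → ℚ) → Set
IsCauchy s = ∀ e → 0ℚ ℚ.< e →
  ∃[ N ] (∀ i j → N ℕ.≤ i → N ℕ.≤ j → ℚ.∣ s i ℚ.- s j ∣ ℚ.≤ e)

record ℝ : Set where
  constructor mkℝ
  field
    seq    : ℕ → ℚ
    cauchy : IsCauchy seq

open ℝ public

infix 4 _≤ℝ_ _<ℝ_

_≤ℝ_ : ℝ → ℝ → Set
x ≤ℝ y = ∀ e → 0ℚ ℚ.< e → ∃[ N ] (∀ i → N ℕ.≤ i → seq x i ℚ.≤ seq y i ℚ.+ e)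

_<ℝ_ : ℝ → ℝ → Set
x <ℝ y = ∃[ e ] 0ℚ ℚ.< e × ∃[ N ] (∀ i → N ℕ.≤ i → seq x i ℚ.+ e ℚ.≤ seq y i)

_≃ℝ_ : ℝ → ℝ → Set
x ≃ℝ y = x ≤ℝ y × y ≤ℝ x

private
  half>0 : ∀ {e} → 0ℚ ℚ.< e → 0ℚ ℚ.< e ℚ.* ½
  half>0 {e} e>0 =
    ℚ.positive⁻¹ (e ℚ.* ½) {{ℚ.pos*pos⇒pos e {{ℚ.positive e>0}} ½}}

  halves : ∀ e → e ℚ.* ½ ℚ.+ e ℚ.* ½ ≡ e
  halves e = trans (sym (ℚ.*-distribˡ-+ e ½ ½)) (ℚ.*-identityʳ e)

fromℚ : ℚ → ℝ
fromℚ q = mkℝ (λ _ → q) λ e e>0 → 0 , λ _ _ _ _ →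
  subst (λ z → ℚ.∣ z ∣ ℚ.≤ e) (sym (ℚ.+-inverseʳ q)) (ℚ.<⇒≤ e>0)

fromℕ : ℕ → ℝ
fromℕ n = fromℚ (+ n ℚ./ 1)

0ℝ 1ℝ : ℝ
0ℝ = fromℚ 0ℚ
1ℝ = fromℚ 1ℚ

infixl 6 _+ℝ_
infixl 7 _*ℝ_

-- The Cauchy proofs are kept abstract so that they are never unfolded
-- during type checking.
abstract
  +-cauchy : ∀ {s t} → IsCauchy s → IsCauchy t → IsCauchy (λ i → s i ℚ.+ t i)
  +-cauchy {s} {t} cs ct e e>0 =
    let (M , p) = cs (e ℚ.* ½) (half>0 e>0)
        (N , q) = ct (e ℚ.* ½) (half>0 e>0)
    in M ⊔ N , λ i j i≥ j≥ → begin
      ℚ.∣ (s i ℚ.+ t i) ℚ.- (s j ℚ.+ t j) ∣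
        ≡⟨ cong ℚ.∣_∣ (swap (s i) (t i) (s j) (t j)) ⟩
      ℚ.∣ (s i ℚ.- s j) ℚ.+ (t i ℚ.- t j) ∣
        ≤⟨ ℚ.∣p+q∣≤∣p∣+∣q∣ (s i ℚ.- s j) (t i ℚ.- t j) ⟩
      ℚ.∣ s i ℚ.- s j ∣ ℚ.+ ℚ.∣ t i ℚ.- t j ∣
        ≤⟨ ℚ.+-mono-≤ (p i j (ℕ.m⊔n≤o⇒m≤o M N i≥) (ℕ.m⊔n≤o⇒m≤o M N j≥))
                      (q i j (ℕ.m⊔n≤o⇒n≤o M N i≥) (ℕ.m⊔n≤o⇒n≤o M N j≥)) ⟩
      e ℚ.* ½ ℚ.+ e ℚ.* ½
        ≡⟨ halves e ⟩
      e ∎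
    where
    open ℚ.≤-Reasoning
    open +-*-Solver
    swap : ∀ a b c d →
           (a ℚ.+ b) ℚ.- (c ℚ.+ d) ≡ (a ℚ.- c) ℚ.+ (b ℚ.- d)
    swap = solve 4 (λ a b c d →
      (a :+ b) :+ (:- (c :+ d)) := (a :+ (:- c)) :+ (b :+ (:- d))) refl

_+ℝ_ : ℝ → ℝ → ℝ
mkℝ s cs +ℝ mkℝ t ct = mkℝ (λ i → s i ℚ.+ t i) (+-cauchy {s} {t} cs ct)

private
  eventuallyBounded : ∀ {s} → IsCauchy s →
    ∃[ b ] 0ℚ ℚ.< b × ∃[ N ] (∀ i → N ℕ.≤ i → ℚ.∣ s i ∣ ℚ.≤ b)
  eventuallyBounded {s} cs =
    let (N , p) = cs 1ℚ (ℚ.positive⁻¹ 1ℚ)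
    in 1ℚ ℚ.+ ℚ.∣ s N ∣
     , ℚ.+-mono-<-≤ (ℚ.positive⁻¹ 1ℚ) (ℚ.0≤∣p∣ (s N))
     , N , λ i i≥ → begin
       ℚ.∣ s i ∣                         ≡⟨ cong ℚ.∣_∣ (split (s i) (s N)) ⟩
       ℚ.∣ (s i ℚ.- s N) ℚ.+ s N ∣       ≤⟨ ℚ.∣p+q∣≤∣p∣+∣q∣ (s i ℚ.- s N) (s N) ⟩
       ℚ.∣ s i ℚ.- s N ∣ ℚ.+ ℚ.∣ s N ∣   ≤⟨ ℚ.+-monoˡ-≤ ℚ.∣ s N ∣ (p i N i≥ ℕ.≤-refl) ⟩
       1ℚ ℚ.+ ℚ.∣ s N ∣                  ∎
    where
    open ℚ.≤-Reasoning
    open +-*-Solver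
    split : ∀ a b → a ≡ (a ℚ.- b) ℚ.+ b
    split = solve 2 (λ a b → a := (a :+ (:- b)) :+ b) refl

  -- For b, e > 0 there is d > 0 with b d = e.
  quotient : ∀ {b e} → 0ℚ ℚ.< b → 0ℚ ℚ.< e → ∃[ d ] 0ℚ ℚ.< d × b ℚ.* d ≡ e
  quotient {b} {e} b>0 e>0 =
    1/b ℚ.* e
    , ℚ.positive⁻¹ (1/b ℚ.* e) {{ℚ.pos*pos⇒pos 1/b {{ℚ.1/pos⇒pos b}} e}}
    , trans (sym (ℚ.*-assoc b 1/b e))
        (trans (cong (ℚ._* e) (ℚ.*-inverseʳ b)) (ℚ.*-identityˡ e))
    where
    instance
      _ = ℚ.positive b>0
      _ = ℚ.positive e>0
      _ = ℚ.pos⇒nonZero b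
    1/b : ℚ
    1/b = ℚ.1/ b

  ∣∣-*-mono : ∀ {p q a b} → ℚ.∣ p ∣ ℚ.≤ a → ℚ.∣ q ∣ ℚ.≤ b →
              ℚ.∣ p ℚ.* q ∣ ℚ.≤ a ℚ.* b
  ∣∣-*-mono {p} {q} {a} {b} p≤a q≤b = begin
    ℚ.∣ p ℚ.* q ∣         ≡⟨ ℚ.∣p*q∣≡∣p∣*∣q∣ p q ⟩
    ℚ.∣ p ∣ ℚ.* ℚ.∣ q ∣   ≤⟨ ℚ.*-monoʳ-≤-nonNeg ℚ.∣ q ∣ {{ℚ.∣-∣-nonNeg q}} p≤a ⟩
    a ℚ.* ℚ.∣ q ∣         ≤⟨ ℚ.*-monoˡ-≤-nonNeg a
                               {{ℚ.nonNegative (ℚ.≤-trans (ℚ.0≤∣p∣ p) p≤a)}} q≤b ⟩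
    a ℚ.* b               ∎
    where open ℚ.≤-Reasoning

abstract
  *-cauchy : ∀ {s t} → IsCauchy s → IsCauchy t → IsCauchy (λ i → s i ℚ.* t i)
  *-cauchy {s} {t} cs ct e e>0 =
    let (a , a>0 , A , s≤a) = eventuallyBounded cs
        (b , b>0 , B , t≤b) = eventuallyBounded ct
        (c , c>0 , ac≡)     = quotient a>0 (half>0 e>0)
        (d , d>0 , bd≡)     = quotient b>0 (half>0 e>0)
        (M , p) = cs d d>0
        (N , q) = ct c c>0
        AM = A ⊔ M
        BN = B ⊔ N
    in AM ⊔ BN , λ i j i≥ j≥ →
      let i≥AM = ℕ.m⊔n≤o⇒m≤o AM BN i≥
          i≥BN = ℕ.m⊔n≤o⇒n≤o AM BN i≥
          j≥AM = ℕ.m⊔n≤o⇒m≤o AM BN j≥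
          j≥BN = ℕ.m⊔n≤o⇒n≤o AM BN j≥
      in begin
      ℚ.∣ s i ℚ.* t i ℚ.- s j ℚ.* t j ∣
        ≡⟨ cong ℚ.∣_∣ (split (s i) (t i) (s j) (t j)) ⟩
      ℚ.∣ s i ℚ.* (t i ℚ.- t j) ℚ.+ t j ℚ.* (s i ℚ.- s j) ∣
        ≤⟨ ℚ.∣p+q∣≤∣p∣+∣q∣ (s i ℚ.* (t i ℚ.- t j)) (t j ℚ.* (s i ℚ.- s j)) ⟩
      ℚ.∣ s i ℚ.* (t i ℚ.- t j) ∣ ℚ.+ ℚ.∣ t j ℚ.* (s i ℚ.- s j) ∣
        ≤⟨ ℚ.+-mono-≤
             (∣∣-*-mono {s i} {t i ℚ.- t j} (s≤a i (ℕ.m⊔n≤o⇒m≤o A M i≥AM))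
               (q i j (ℕ.m⊔n≤o⇒n≤o B N i≥BN) (ℕ.m⊔n≤o⇒n≤o B N j≥BN)))
             (∣∣-*-mono {t j} {s i ℚ.- s j} (t≤b j (ℕ.m⊔n≤o⇒m≤o B N j≥BN))
               (p i j (ℕ.m⊔n≤o⇒n≤o A M i≥AM) (ℕ.m⊔n≤o⇒n≤o A M j≥AM))) ⟩
      a ℚ.* c ℚ.+ b ℚ.* d
        ≡⟨ cong₂ ℚ._+_ ac≡ bd≡ ⟩
      e ℚ.* ½ ℚ.+ e ℚ.* ½
        ≡⟨ halves e ⟩
      e ∎
    where
    open ℚ.≤-Reasoning
    open +-*-Solver
    split : ∀ a b c d → a ℚ.* b ℚ.- c ℚ.* d ≡
                        a ℚ.* (b ℚ.- d) ℚ.+ d ℚ.* (a ℚ.- c)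
    split = solve 4 (λ a b c d →
      (a :* b) :+ (:- (c :* d)) :=
      (a :* (b :+ (:- d))) :+ (d :* (a :+ (:- c)))) refl

_*ℝ_ : ℝ → ℝ → ℝ
mkℝ s cs *ℝ mkℝ t ct = mkℝ (λ i → s i ℚ.* t i) (*-cauchy {s} {t} cs ct)

partialSum : (ℕ → ℝ) → ℕ → ℝ
partialSum x zero    = 0ℝ
partialSum x (suc N) = partialSum x N +ℝ x N

_ConvergesTo_ : (ℕ → ℝ) → ℝ → Set
x ConvergesTo l = ∀ e → 0ℚ ℚ.< e →
  ∃[ N ] (∀ i → N ℕ.≤ i → x i ≤ℝ l +ℝ fromℚ e × l ≤ℝ x i +ℝ fromℚ e)

------------------------------------------------------------------------
-- log₂ n is the limit of ⌊log₂ nᵏ⌋ / k as k → ∞.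

private
  n<2[1+⌊n/2⌋] : ∀ n → n ℕ.< 2 ℕ.* suc ℕ.⌊ n /2⌋
  n<2[1+⌊n/2⌋] zero          = s≤s z≤n
  n<2[1+⌊n/2⌋] (suc zero)    = s≤s (s≤s z≤n)
  n<2[1+⌊n/2⌋] (suc (suc n)) =
    subst (suc (suc n) ℕ.<_) (sym (ℕ.*-suc 2 (suc ℕ.⌊ n /2⌋)))
      (s≤s (s≤s (n<2[1+⌊n/2⌋] n)))

  2⌊n/2⌋≤n : ∀ n → 2 ℕ.* ℕ.⌊ n /2⌋ ℕ.≤ n
  2⌊n/2⌋≤n zero          = z≤n
  2⌊n/2⌋≤n (suc zero)    = z≤n
  2⌊n/2⌋≤n (suc (suc n)) =
    subst (ℕ._≤ suc (suc n)) (sym (ℕ.*-suc 2 ℕ.⌊ n /2⌋)) (s≤s (s≤s (2⌊n/2⌋≤n n)))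

  2^⌊log₂n⌋≤n : ∀ n .{{_ : ℕ.NonZero n}} → 2 ℕ.^ ⌊log₂ n ⌋ ℕ.≤ n
  2^⌊log₂n⌋≤n = <-rec (λ n → .{{_ : ℕ.NonZero n}} → 2 ℕ.^ ⌊log₂ n ⌋ ℕ.≤ n) step
    where
    open ℕ.≤-Reasoning
    step : ∀ n → (∀ {m} → m ℕ.< n → .{{_ : ℕ.NonZero m}} → 2 ℕ.^ ⌊log₂ m ⌋ ℕ.≤ m) →
           .{{_ : ℕ.NonZero n}} → 2 ℕ.^ ⌊log₂ n ⌋ ℕ.≤ n
    step (suc zero)          rec = s≤s z≤n
    step n@(suc (suc k)) rec = begin
      2 ℕ.^ ⌊log₂ n ⌋
        ≤⟨ ℕ.^-monoʳ-≤ 2 (ℕ.m≤n+m∸n ⌊log₂ n ⌋ 1) ⟩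
      2 ℕ.* 2 ℕ.^ (⌊log₂ n ⌋ ℕ.∸ 1)
        ≡⟨ cong (λ z → 2 ℕ.* 2 ℕ.^ z) (sym (⌊log₂⌊n/2⌋⌋≡⌊log₂n⌋∸1 n)) ⟩
      2 ℕ.* 2 ℕ.^ ⌊log₂ ℕ.⌊ n /2⌋ ⌋
        ≤⟨ ℕ.*-monoʳ-≤ 2 (rec (ℕ.⌊n/2⌋<n (suc k))) ⟩
      2 ℕ.* ℕ.⌊ n /2⌋
        ≤⟨ 2⌊n/2⌋≤n n ⟩
      n ∎

  n<2^[1+⌊log₂n⌋] : ∀ n → n ℕ.< 2 ℕ.^ suc ⌊log₂ n ⌋
  n<2^[1+⌊log₂n⌋] n = ℕ.≰⇒> λ 2^≤n → ℕ.<-irrefl refl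
    (subst (ℕ._≤ ⌊log₂ n ⌋) (⌊log₂[2^n]⌋≡n (suc ⌊log₂ n ⌋)) (⌊log₂⌋-mono-≤ 2^≤n))

  2^-reflects-< : ∀ {a b} → 2 ℕ.^ a ℕ.< 2 ℕ.^ b → a ℕ.< b
  2^-reflects-< {a} {b} 2^a<2^b = ℕ.≰⇒> λ b≤a →
    ℕ.<⇒≱ 2^a<2^b (ℕ.^-monoʳ-≤ 2 b≤a)

  logs-compare : ∀ n .{{_ : ℕ.NonZero n}} k l →
    ⌊log₂ (n ℕ.^ suc k) ⌋ ℕ.* suc l ℕ.< suc ⌊log₂ (n ℕ.^ suc l) ⌋ ℕ.* suc k
  logs-compare n k l = 2^-reflects-< (begin-strict
    2 ℕ.^ (a ℕ.* suc l)            ≡⟨ sym (ℕ.^-*-assoc 2 a (suc l)) ⟩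
    (2 ℕ.^ a) ℕ.^ suc l            ≤⟨ ℕ.^-monoˡ-≤ (suc l)
                                        (2^⌊log₂n⌋≤n (n ℕ.^ suc k) {{ℕ.m^n≢0 n (suc k)}}) ⟩
    (n ℕ.^ suc k) ℕ.^ suc l        ≡⟨ ℕ.^-*-assoc n (suc k) (suc l) ⟩
    n ℕ.^ (suc k ℕ.* suc l)        ≡⟨ cong (n ℕ.^_) (ℕ.*-comm (suc k) (suc l)) ⟩
    n ℕ.^ (suc l ℕ.* suc k)        ≡⟨ sym (ℕ.^-*-assoc n (suc l) (suc k)) ⟩
    (n ℕ.^ suc l) ℕ.^ suc k        <⟨ ℕ.^-monoˡ-< (suc k) (n<2^[1+⌊log₂n⌋] (n ℕ.^ suc l)) ⟩
    (2 ℕ.^ suc b) ℕ.^ suc k        ≡⟨ ℕ.^-*-assoc 2 (suc b) (suc k) ⟩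
    2 ℕ.^ (suc b ℕ.* suc k)        ∎)
    where
    open ℕ.≤-Reasoning
    a = ⌊log₂ (n ℕ.^ suc k) ⌋
    b = ⌊log₂ (n ℕ.^ suc l) ⌋

  fraction-≤ : ∀ a b c d → a ℕ.* suc d ℕ.≤ c ℕ.* suc b →
               + a ℚ./ suc b ℚ.≤ + c ℚ./ suc d
  fraction-≤ a b c d ad≤cb = ℚ.toℚᵘ-cancel-≤ (begin
    ℚ.toℚᵘ (+ a ℚ./ suc b)   ≃⟨ ℚ.toℚᵘ-fromℚᵘ (ℚᵘ.mkℚᵘ (+ a) b) ⟩
    ℚᵘ.mkℚᵘ (+ a) b          ≤⟨ ℚᵘ.*≤* (subst₂ ℤ._≤_ (ℤ.pos-* a (suc d))
                                         (ℤ.pos-* c (suc b)) (ℤ.+≤+ ad≤cb)) ⟩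
    ℚᵘ.mkℚᵘ (+ c) d          ≃⟨ ℚᵘ.≃-sym (ℚ.toℚᵘ-fromℚᵘ (ℚᵘ.mkℚᵘ (+ c) d)) ⟩
    ℚ.toℚᵘ (+ c ℚ./ suc d)   ∎)
    where open ℚᵘ.≤-Reasoning

  suc-fraction : ∀ a b → + suc a ℚ./ suc b ≡ + a ℚ./ suc b ℚ.+ + 1 ℚ./ suc b
  suc-fraction a b = ℚ.toℚᵘ-injective (begin-equality
    ℚ.toℚᵘ (+ suc a ℚ./ suc b)
      ≃⟨ ℚ.toℚᵘ-fromℚᵘ (ℚᵘ.mkℚᵘ (+ suc a) b) ⟩
    ℚᵘ.mkℚᵘ (+ suc a) b
      ≃⟨ ℚᵘ.*≡* (trans (sym (ℤ.pos-* (suc a) (suc b ℕ.* suc b)))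
           (trans (cong +_ nat) (trans (ℤ.pos-* (a ℕ.* suc b ℕ.+ 1 ℕ.* suc b) (suc b))
             (cong (ℤ._* + suc b)
               (trans (ℤ.pos-+ (a ℕ.* suc b) (1 ℕ.* suc b))
                 (cong₂ ℤ._+_ (ℤ.pos-* a (suc b)) (ℤ.pos-* 1 (suc b)))))))) ⟩
    ℚᵘ.mkℚᵘ (+ a) b ℚᵘ.+ ℚᵘ.mkℚᵘ (+ 1) b
      ≃⟨ ℚᵘ.≃-sym (ℚᵘ.+-cong (ℚ.toℚᵘ-fromℚᵘ (ℚᵘ.mkℚᵘ (+ a) b))
                             (ℚ.toℚᵘ-fromℚᵘ (ℚᵘ.mkℚᵘ (+ 1) b))) ⟩
    ℚ.toℚᵘ (+ a ℚ./ suc b) ℚᵘ.+ ℚ.toℚᵘ (+ 1 ℚ./ suc b)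
      ≃⟨ ℚᵘ.≃-sym (ℚ.toℚᵘ-homo-+ (+ a ℚ./ suc b) (+ 1 ℚ./ suc b)) ⟩
    ℚ.toℚᵘ (+ a ℚ./ suc b ℚ.+ + 1 ℚ./ suc b) ∎)
    where
    open ℚᵘ.≤-Reasoning
    nat : suc a ℕ.* (suc b ℕ.* suc b) ≡ (a ℕ.* suc b ℕ.+ 1 ℕ.* suc b) ℕ.* suc b
    nat = trans (sym (ℕ.*-assoc (suc a) (suc b) (suc b)))
      (cong (ℕ._* suc b) (trans (ℕ.*-distribʳ-+ (suc b) 1 a)
        (ℕ.+-comm (1 ℕ.* suc b) (a ℕ.* suc b))))

  archimedean : ∀ e → 0ℚ ℚ.< e → ∃[ N ] (∀ i → N ℕ.≤ i → + 1 ℚ./ suc i ℚ.≤ e)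
  archimedean e e>0 = go e {{ℚ.positive e>0}}
    where
    go : ∀ e .{{_ : ℚ.Positive e}} → ∃[ N ] (∀ i → N ℕ.≤ i → + 1 ℚ./ suc i ℚ.≤ e)
    go e@(mkℚ (+ suc a) d _) = d , λ i d≤i →
      subst (+ 1 ℚ./ suc i ℚ.≤_) (ℚ.↥p/↧p≡p e)
        (fraction-≤ 1 i (suc a) d (ℕ.*-mono-≤ {1} {suc a} (s≤s z≤n) (s≤s d≤i)))

  ∣-∣-≤ : ∀ {p q e} → p ℚ.≤ q ℚ.+ e → q ℚ.≤ p ℚ.+ e → ℚ.∣ p ℚ.- q ∣ ℚ.≤ e
  ∣-∣-≤ {p} {q} {e} p≤ q≤ with ℚ.∣p∣≡p∨∣p∣≡-p (p ℚ.- q)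
  ... | inj₁ eq = begin
    ℚ.∣ p ℚ.- q ∣        ≡⟨ eq ⟩
    p ℚ.- q              ≤⟨ ℚ.+-monoˡ-≤ (ℚ.- q) p≤ ⟩
    (q ℚ.+ e) ℚ.- q      ≡⟨ solve 2 (λ q e → (q :+ e) :+ (:- q) := e) refl q e ⟩
    e                    ∎
    where open ℚ.≤-Reasoning
          open +-*-Solver
  ... | inj₂ eq = begin
    ℚ.∣ p ℚ.- q ∣        ≡⟨ eq ⟩
    ℚ.- (p ℚ.- q)        ≡⟨ solve 2 (λ p q → :- (p :+ (:- q)) := q :+ (:- p)) refl p q ⟩
    q ℚ.- p              ≤⟨ ℚ.+-monoˡ-≤ (ℚ.- p) q≤ ⟩
    (p ℚ.+ e) ℚ.- p      ≡⟨ solve 2 (λ q e → (q :+ e) :+ (:- q) := e) refl p e ⟩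
    e                    ∎
    where open ℚ.≤-Reasoning
          open +-*-Solver

log₂-seq : ℕ → ℕ → ℚ
log₂-seq n i = + ⌊log₂ (n ℕ.^ suc i) ⌋ ℚ./ suc i

abstract
  log₂-cauchy : ∀ n .{{_ : ℕ.NonZero n}} → IsCauchy (log₂-seq n)
  log₂-cauchy n e e>0 =
    let (N , small) = archimedean e e>0
    in N , λ i j i≥ j≥ →
      ∣-∣-≤ (ℚ.≤-trans (close i j) (ℚ.+-monoʳ-≤ (log₂-seq n j) (small j j≥)))
            (ℚ.≤-trans (close j i) (ℚ.+-monoʳ-≤ (log₂-seq n i) (small i i≥)))
    where
    ℓ : ℕ → ℕ
    ℓ i = ⌊log₂ (n ℕ.^ suc i) ⌋
    close : ∀ i j → log₂-seq n i ℚ.≤ log₂-seq n j ℚ.+ + 1 ℚ./ suc j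
    close i j = subst (log₂-seq n i ℚ.≤_) (suc-fraction (ℓ j) j)
      (fraction-≤ (ℓ i) i (suc (ℓ j)) j (ℕ.<⇒≤ (logs-compare n i j)))

log₂ : ∀ n .{{_ : ℕ.NonZero n}} → ℝ
log₂ n = mkℝ (log₂-seq n) (log₂-cauchy n)

------------------------------------------------------------------------
-- Probability spaces.  Events are Boolean-valued predicates on Ω;
-- classically these are all the subsets of Ω, so `Measurable` is a
-- σ-algebra and `P` a countably additive probability measure on it.

_IsUnionOf_ : {Ω : Set} → (Ω → Bool) → (ℕ → Ω → Bool) → Set
F IsUnionOf E = ∀ ω → T (F ω) ⇔ (∃[ i ] T (E i ω))

Disjoint : {Ω : Set} → (ℕ → Ω → Bool) → Set
Disjoint E = ∀ i j → i ≢ j → ∀ ω → ¬ (T (E i ω) × T (E j ω))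

record ProbabilitySpace (Ω : Set) : Set₁ where
  field
    Measurable : (Ω → Bool) → Set
    full       : Measurable (λ _ → true)
    complement : ∀ {E} → Measurable E → Measurable (not ∘ E)
    union      : ∀ {E F} → F IsUnionOf E → (∀ i → Measurable (E i)) → Measurable F

    P          : (E : Ω → Bool) → Measurable E → ℝ
    P-nonneg   : ∀ {E} (mE : Measurable E) → 0ℝ ≤ℝ P E mE
    P-full     : P (λ _ → true) full ≃ℝ 1ℝ
    P-empty    : (m∅ : Measurable (λ _ → false)) → P (λ _ → false) m∅ ≃ℝ 0ℝ
    P-union    : ∀ {E F} → F IsUnionOf E → Disjoint E →
                 (mE : ∀ i → Measurable (E i)) (mF : Measurable F) →
                 partialSum (λ i → P (E i) (mE i)) ConvergesTo P F mF

module _ {Ω : Set} (𝒫 : ProbabilitySpace Ω) where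
  open ProbabilitySpace 𝒫

  hasValue : (Ω → ℕ) → ℕ → Ω → Bool
  hasValue X k ω = ⌊ X ω ℕ.≟ k ⌋

  IsRandomVariable : (Ω → ℕ) → Set
  IsRandomVariable X = ∀ k → Measurable (hasValue X k)

  -- Since X ≤ M everywhere, the sum over k ≤ M is the whole expectation.
  𝔼 : (X : Ω → ℕ) → IsRandomVariable X → ∀ M → (∀ ω → X ω ℕ.≤ M) → ℝ
  𝔼 X mX M _ = partialSum (λ k → fromℕ k *ℝ P (hasValue X k) (mX k)) (suc M)

------------------------------------------------------------------------

open Sums ℕ.+-0-commutativeMonoid using (sum)

Color : Set
Color = Fin 2

Coloring : ℕ → Set
Coloring n = Fin n → Color

Edge : ℕ → Set
Edge n = Fin n × Fin n

Proper : ∀ {n} → List (Edge n) → Coloring n → Set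
Proper σ c = All (λ (u , v) → c u ≢ c v) σ

classWeight : ∀ {n} → (Fin n → ℕ) → Coloring n → Color → ℕ
classWeight w c k = sum λ v → if ⌊ c v ≟ k ⌋ then w v else 0

record Instance (n : ℕ) : Set where
  field
    w : Fin n → ℕ

  totalWeight : ℕ
  totalWeight = sum w

  B : ℕ
  B = totalWeight / 2

  field
    w-positive  : ∀ v → 0 ℕ.< w v
    total-even  : 2 ∣ totalWeight
    w≤B         : ∀ v → w v ℕ.≤ B
    c₀          : Coloring n
    c₀-balanced : ∀ k → classWeight w c₀ k ℕ.≤ B

module _ {n : ℕ} (I : Instance n) where
  open Instance I

  WithinCapacity : ℝ → Coloring n → Set
  WithinCapacity K c = ∀ k → fromℕ (classWeight w c k) ≤ℝ K

  Admissible : List (Edge n) → Set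
  Admissible σ = ∃[ c ] Proper σ c × WithinCapacity (fromℕ B) c

  recoloringCost : Coloring n → Coloring n → ℕ
  recoloringCost c d = sum λ v → if ⌊ c v ≟ d v ⌋ then 0 else w v

  -- The cost of the first T steps of a sequence of colorings
  -- c 0, c 1, c 2, …, where c t is the coloring after request t.
  totalCost : ℕ → (ℕ → Coloring n) → ℕ
  totalCost zero    c = 0
  totalCost (suc T) c = totalCost T c ℕ.+ recoloringCost (c T) (c (suc T))

  -- Only the entries c 0, …, c T with T = length σ are constrained.
  record Serves (K : ℝ) (σ : List (Edge n)) (c : ℕ → Coloring n) : Set where
    field
      initial  : ∀ v → c 0 v ≡ c₀ v
      proper   : ∀ t → 1 ℕ.≤ t → t ℕ.≤ length σ → Proper (take t σ) (c t)
      capacity : ∀ t → 1 ℕ.≤ t → t ℕ.≤ length σ → WithinCapacity K (c t)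

  record IsOPT (σ : List (Edge n)) (m : ℕ) : Set where
    field
      attained : ∃[ c ] Serves (fromℕ B) σ c × totalCost (length σ) c ≡ m
      minimal  : ∀ c → Serves (fromℕ B) σ c → m ℕ.≤ totalCost (length σ) c

  run : (List (Edge n) → Coloring n) → List (Edge n) → ℕ → Coloring n
  run output σ zero    = c₀
  run output σ (suc t) = output (take (suc t) σ)

  record OnlineAlgorithm (ε : ℝ) : Set where
    field
      output  : List (Edge n) → Coloring n
      correct : ∀ σ → Admissible σ →
                Serves ((1ℝ +ℝ ε) *ℝ fromℕ B) σ (run output σ)

  cost : ∀ {ε} → List (Edge n) → OnlineAlgorithm ε → ℕ
  cost σ A = totalCost (length σ) (run (OnlineAlgorithm.output A) σ)

  cost-bound : ∀ {ε} σ (A : OnlineAlgorithm ε) → cost σ A ℕ.≤ length σ ℕ.* totalWeight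
  cost-bound σ A = steps (length σ)
    where
    sum-mono : ∀ {m} {f g : Fin m → ℕ} → (∀ v → f v ℕ.≤ g v) → sum f ℕ.≤ sum g
    sum-mono {zero}  f≤g = z≤n
    sum-mono {suc m} f≤g = ℕ.+-mono-≤ (f≤g zero) (sum-mono (f≤g ∘ suc))

    if-≤ : ∀ b x → (if b then 0 else x) ℕ.≤ x
    if-≤ true  x = z≤n
    if-≤ false x = ℕ.≤-refl

    c = run (OnlineAlgorithm.output A) σ

    steps : ∀ T → totalCost T c ℕ.≤ T ℕ.* totalWeight
    steps zero    = z≤n
    steps (suc T) = subst (totalCost (suc T) c ℕ.≤_) (ℕ.+-comm _ totalWeight)
      (ℕ.+-mono-≤ (steps T) (sum-mono λ v → if-≤ ⌊ c T v ≟ c (suc T) v ⌋ (w v)))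

  -- A probability distribution over deterministic algorithms for which
  -- the cost on each fixed request sequence is a random variable.
  record RandomizedAlgorithm (ε : ℝ) : Set₁ where
    field
      distribution    : ProbabilitySpace (OnlineAlgorithm ε)
      cost-measurable : ∀ σ → IsRandomVariable distribution (cost σ)

    expectedCost : List (Edge n) → ℝ
    expectedCost σ =
      𝔼 distribution (cost σ) (cost-measurable σ) (length σ ℕ.* totalWeight) (cost-bound σ)

  CompetitiveWith : ∀ {ε} → RandomizedAlgorithm ε → ℝ → Set
  CompetitiveWith 𝒜 α = ∀ σ → Admissible σ → ∀ opt → IsOPT σ opt →
    RandomizedAlgorithm.expectedCost 𝒜 σ ≤ℝ α *ℝ fromℕ opt

{-# OPTIONS --safe #-}
module Submission where

-- The oblivious adversary first pairs up 2ᵏ⁺¹ vertices of weight 1 and then merges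
-- components of equal size along a balanced binary tree.  Each merge joins a
-- vertex of one component to one of two differently colored vertices of the
-- other, chosen by a fair coin, so with probability at least ½ one of the two
-- components must be recolored completely, whatever the capacity.  This costs
-- k 2ᵏ / 2 in expectation, while the offline algorithm recolors at most all 2ᵏ⁺¹
-- vertices once; every component is balanced because it consists of bichromatic
-- pairs.  Averaging over the coins (Yao's principle) gives α ≥ k / 4.

open import Defs
open import Algebra.Properties.CommutativeMonoid.Sum as Sums using ()
open import Data.Bool.Base using (Bool; true; false; not; T; _∧_; _∨_; _xor_; if_then_else_)
import Data.Bool.Properties as Bool
open import Data.Empty using (⊥-elim)
open import Data.Fin.Base using (Fin; zero; suc; _↑ˡ_; _↑ʳ_; splitAt)
import Data.Fin.Properties as Fin
open import Data.Integer.Base as ℤ using (+_)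
import Data.Integer.Properties as ℤ
open import Data.List.Base using (List; []; _∷_; _++_; _∷ʳ_; length; take; map)
import Data.List.Properties as List
open import Data.List.Relation.Unary.All as All using (All; []; _∷_)
import Data.List.Relation.Unary.All.Properties as All
open import Data.Nat.Base as ℕ using (ℕ; zero; suc; _⊔_; z≤n; s≤s; NonZero; _≤_)
open import Data.Nat.Divisibility using (divides)
open import Data.Nat.DivMod using (_/_; m*n/n≡m)
open import Data.Nat.ListAction using (sum)
open import Data.Nat.ListAction.Properties using (sum-++)
open import Data.Nat.Logarithm using (⌊log₂_⌋; ⌊log₂⌋-mono-≤; ⌊log₂[2^n]⌋≡n)
import Data.Nat.Properties as ℕ
open import Data.Nat.Solver using () renaming (module +-*-Solver to ℕ-Solver)
open import Data.Product using (Σ-syntax; ∃-syntax; _×_; _,_; proj₁; proj₂)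
open import Data.Rational.Base as ℚ using (ℚ; 0ℚ; 1ℚ; ½)
import Data.Rational.Properties as ℚ
open import Data.Rational.Solver using (module +-*-Solver)
import Data.Rational.Unnormalised.Base as ℚᵘ
import Data.Rational.Unnormalised.Properties as ℚᵘ
open import Data.Sum.Base using (_⊎_; inj₁; inj₂; [_,_]′)
open import Data.Unit.Base using (⊤; tt)
open import Function.Base using (_∘_; id)
open import Function.Bundles using (mk⇔)
open import Relation.Binary.PropositionalEquality
  using (_≡_; _≢_; refl; sym; trans; cong; cong₂; subst; subst₂)
import Relation.Binary.Reasoning.Base.Single as Single
open import Relation.Nullary using (¬_; Dec; yes; no)
open import Relation.Nullary.Decidable using (⌊_⌋; toWitness; fromWitness)

open Sums ℕ.+-0-commutativeMonoid using (∑-distrib-+; sum-cong-≗) renaming (sum to ∑)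

-- Real numbers

-- The adversary's coins are not modeled as a probability space. Costs are summed over the full list
-- of coin outcomes, which keeps the argument for one deterministic algorithm inside the natural
-- numbers. Passing to a randomized algorithm needs a lower bound on a sum of expectations. It is
-- proved by splitting the space along the values of one cost at a time, so the sum itself is never
-- treated as a random variable. Two obstacles come from constructive reasoning. The offline minimum
-- is obtained only up to double negation, which is harmless because `≤ℝ` is stable. Moreover the
-- sign of `α` is unknown, so an upper bound on the optimum cannot be substituted under `α`; the
-- actual sum of the optima is carried along until the last division. The constant 1/16 is the
-- product of the 1/4 in `α ≥ k / 4` and the 1/4 lost in log₂ n ≤ k + 3 ≤ 4k.

p≤p+q : ∀ {p q} → 0ℚ ℚ.≤ q → p ℚ.≤ p ℚ.+ q
p≤p+q {p} {q} 0≤q = subst (ℚ._≤ p ℚ.+ q) (ℚ.+-identityʳ p) (ℚ.+-monoʳ-≤ p 0≤q)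

p≤∣p∣ : ∀ p → p ℚ.≤ ℚ.∣ p ∣
p≤∣p∣ p with ℚ.≤-total 0ℚ p
... | inj₁ 0≤p = ℚ.≤-reflexive (sym (ℚ.0≤p⇒∣p∣≡p 0≤p))
... | inj₂ p≤0 = ℚ.≤-trans p≤0 (ℚ.0≤∣p∣ p)

ι : ℕ → ℚ
ι n = + n ℚ./ 1

ι-suc : ∀ n → ι (suc n) ≡ 1ℚ ℚ.+ ι n
ι-suc n = ℚ.toℚᵘ-injective (begin-equality
  ℚ.toℚᵘ (ι (suc n))                  ≃⟨ ℚ.toℚᵘ-fromℚᵘ (ℚᵘ.mkℚᵘ (+ suc n) 0) ⟩
  ℚᵘ.mkℚᵘ (+ suc n) 0                 ≃⟨ ℚᵘ.*≡* (cong (λ z → (+ 1 ℤ.+ z) ℤ.* + 1) (sym (ℤ.*-identityʳ (+ n)))) ⟩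
  ℚᵘ.1ℚᵘ ℚᵘ.+ ℚᵘ.mkℚᵘ (+ n) 0         ≃⟨ ℚᵘ.+-congʳ ℚᵘ.1ℚᵘ (ℚᵘ.≃-sym (ℚ.toℚᵘ-fromℚᵘ (ℚᵘ.mkℚᵘ (+ n) 0))) ⟩
  ℚᵘ.1ℚᵘ ℚᵘ.+ ℚ.toℚᵘ (ι n)            ≃⟨ ℚᵘ.≃-sym (ℚ.toℚᵘ-homo-+ 1ℚ (ι n)) ⟩
  ℚ.toℚᵘ (1ℚ ℚ.+ ι n)                 ∎)
  where open ℚᵘ.≤-Reasoning

ι-+ : ∀ m n → ι (m ℕ.+ n) ≡ ι m ℚ.+ ι n
ι-+ zero    n = sym (ℚ.+-identityˡ (ι n))
ι-+ (suc m) n = trans (ι-suc (m ℕ.+ n)) (trans (cong (1ℚ ℚ.+_) (ι-+ m n))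
  (trans (sym (ℚ.+-assoc 1ℚ (ι m) (ι n))) (cong (ℚ._+ ι n) (sym (ι-suc m)))))

ι-* : ∀ m n → ι (m ℕ.* n) ≡ ι m ℚ.* ι n
ι-* zero    n = sym (ℚ.*-zeroˡ (ι n))
ι-* (suc m) n = trans (ι-+ n (m ℕ.* n)) (trans (cong (ι n ℚ.+_) (ι-* m n))
  (trans (solve 2 (λ a b → b :+ a :* b := (con 1ℚ :+ a) :* b) refl (ι m) (ι n))
    (cong (ℚ._* ι n) (sym (ι-suc m)))))
  where open +-*-Solver

0≤ι : ∀ n → 0ℚ ℚ.≤ ι n
0≤ι n = ℚ.nonNegative⁻¹ (ι n) {{ℚ.normalize-nonNeg n 1}}

ι-mono-≤ : ∀ {m n} → m ℕ.≤ n → ι m ℚ.≤ ι n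
ι-mono-≤ {m} {n} m≤n = subst (ι m ℚ.≤_)
  (trans (sym (ι-+ m (n ℕ.∸ m))) (cong ι (ℕ.m+[n∸m]≡n m≤n)))
  (p≤p+q {ι m} (0≤ι (n ℕ.∸ m)))

½*-pos : ∀ {e} → 0ℚ ℚ.< e → 0ℚ ℚ.< e ℚ.* ½
½*-pos {e} e>0 = ℚ.positive⁻¹ (e ℚ.* ½) {{ℚ.pos*pos⇒pos e {{ℚ.positive e>0}} ½}}

½+½ : ∀ e → e ℚ.* ½ ℚ.+ e ℚ.* ½ ≡ e
½+½ e = trans (sym (ℚ.*-distribˡ-+ e ½ ½)) (ℚ.*-identityʳ e)

pointwise-≤ : ∀ {x y} → (∀ i → seq x i ℚ.≤ seq y i) → x ≤ℝ y
pointwise-≤ {x} {y} x≤y e e>0 = 0 , λ i _ →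
  ℚ.≤-trans (x≤y i) (p≤p+q (ℚ.<⇒≤ e>0))

pointwise-≡ : ∀ {x y} → (∀ i → seq x i ≡ seq y i) → x ≤ℝ y
pointwise-≡ {x} {y} x≡y = pointwise-≤ {x} {y} (ℚ.≤-reflexive ∘ x≡y)

≤ℝ-refl : ∀ {x} → x ≤ℝ x
≤ℝ-refl {x} = pointwise-≡ {x} {x} (λ _ → refl)

≤ℝ-trans : ∀ {x y z} → x ≤ℝ y → y ≤ℝ z → x ≤ℝ z
≤ℝ-trans {x} {y} {z} x≤y y≤z e e>0 =
  let (M , p) = x≤y (e ℚ.* ½) (½*-pos e>0)
      (N , q) = y≤z (e ℚ.* ½) (½*-pos e>0)
  in M ⊔ N , λ i i≥ → begin
    seq x i                                  ≤⟨ p i (ℕ.m⊔n≤o⇒m≤o M N i≥) ⟩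
    seq y i ℚ.+ e ℚ.* ½                      ≤⟨ ℚ.+-monoˡ-≤ (e ℚ.* ½) (q i (ℕ.m⊔n≤o⇒n≤o M N i≥)) ⟩
    seq z i ℚ.+ e ℚ.* ½ ℚ.+ e ℚ.* ½          ≡⟨ ℚ.+-assoc (seq z i) (e ℚ.* ½) (e ℚ.* ½) ⟩
    seq z i ℚ.+ (e ℚ.* ½ ℚ.+ e ℚ.* ½)        ≡⟨ cong (seq z i ℚ.+_) (½+½ e) ⟩
    seq z i ℚ.+ e                            ∎
  where open ℚ.≤-Reasoning

+ℝ-mono-≤ : ∀ {x y u v} → x ≤ℝ y → u ≤ℝ v → x +ℝ u ≤ℝ y +ℝ v
+ℝ-mono-≤ {x} {y} {u} {v} x≤y u≤v e e>0 =
  let (M , p) = x≤y (e ℚ.* ½) (½*-pos e>0)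
      (N , q) = u≤v (e ℚ.* ½) (½*-pos e>0)
  in M ⊔ N , λ i i≥ → begin
    seq x i ℚ.+ seq u i
      ≤⟨ ℚ.+-mono-≤ (p i (ℕ.m⊔n≤o⇒m≤o M N i≥)) (q i (ℕ.m⊔n≤o⇒n≤o M N i≥)) ⟩
    (seq y i ℚ.+ e ℚ.* ½) ℚ.+ (seq v i ℚ.+ e ℚ.* ½)
      ≡⟨ solve 3 (λ a b c → (a :+ c) :+ (b :+ c) := (a :+ b) :+ (c :+ c)) refl
           (seq y i) (seq v i) (e ℚ.* ½) ⟩
    (seq y i ℚ.+ seq v i) ℚ.+ (e ℚ.* ½ ℚ.+ e ℚ.* ½)
      ≡⟨ cong (seq y i ℚ.+ seq v i ℚ.+_) (½+½ e) ⟩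
    (seq y i ℚ.+ seq v i) ℚ.+ e ∎
  where open ℚ.≤-Reasoning
        open +-*-Solver

-- Multiplication by k + 1 is repeated addition, which spares a division of the
-- error term by k + 1.
fromℕ-*-mono-≤ : ∀ k {x y} → x ≤ℝ y → fromℕ k *ℝ x ≤ℝ fromℕ k *ℝ y
fromℕ-*-mono-≤ zero {x} {y} x≤y = pointwise-≡ {fromℕ 0 *ℝ x} {fromℕ 0 *ℝ y}
  λ i → trans (ℚ.*-zeroˡ (seq x i)) (sym (ℚ.*-zeroˡ (seq y i)))
fromℕ-*-mono-≤ (suc k) {x} {y} x≤y =
  ≤ℝ-trans {fromℕ (suc k) *ℝ x} {x +ℝ fromℕ k *ℝ x} {fromℕ (suc k) *ℝ y}
    (pointwise-≡ {fromℕ (suc k) *ℝ x} {x +ℝ fromℕ k *ℝ x} (λ i → unfold (seq x i)))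
    (≤ℝ-trans {x +ℝ fromℕ k *ℝ x} {y +ℝ fromℕ k *ℝ y} {fromℕ (suc k) *ℝ y}
      (+ℝ-mono-≤ {x} {y} {fromℕ k *ℝ x} {fromℕ k *ℝ y} x≤y (fromℕ-*-mono-≤ k {x} {y} x≤y))
      (pointwise-≡ {y +ℝ fromℕ k *ℝ y} {fromℕ (suc k) *ℝ y} (λ i → sym (unfold (seq y i)))))
  where
  open +-*-Solver
  unfold : ∀ q → ι (suc k) ℚ.* q ≡ q ℚ.+ ι k ℚ.* q
  unfold q = trans (cong (ℚ._* q) (ι-suc k))
    (solve 2 (λ a b → (con 1ℚ :+ a) :* b := b :+ a :* b) refl (ι k) q)

-- Turns the approximate inequalities supplied by a limit into an exact one; half of the error pays
-- for the hypothesis, half for its own tolerance.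
≤ℝ-closed : ∀ {x y} → (∀ e → 0ℚ ℚ.< e → x ≤ℝ y +ℝ fromℚ e) → x ≤ℝ y
≤ℝ-closed {x} {y} x≤y+ e e>0 =
  let (N , p) = x≤y+ (e ℚ.* ½) (½*-pos e>0) (e ℚ.* ½) (½*-pos e>0)
  in N , λ i i≥ → subst (seq x i ℚ.≤_)
    (trans (ℚ.+-assoc (seq y i) (e ℚ.* ½) (e ℚ.* ½)) (cong (seq y i ℚ.+_) (½+½ e))) (p i i≥)

∣-∣≤⇒≤+ : ∀ {p q e} → ℚ.∣ p ℚ.- q ∣ ℚ.≤ e → p ℚ.≤ q ℚ.+ e
∣-∣≤⇒≤+ {p} {q} {e} h = begin
  p                    ≡⟨ solve 2 (λ p q → p := q :+ (p :+ (:- q))) refl p q ⟩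
  q ℚ.+ (p ℚ.- q)      ≤⟨ ℚ.+-monoʳ-≤ q (ℚ.≤-trans (p≤∣p∣ (p ℚ.- q)) h) ⟩
  q ℚ.+ e              ∎
  where open ℚ.≤-Reasoning
        open +-*-Solver

-- With rational approximations within d of x and y, either the approximations
-- already show x ≤ y + 8d or they show x > y + d.
≤ℝ-stable : ∀ {x y} → ¬ ¬ (x ≤ℝ y) → x ≤ℝ y
≤ℝ-stable {x} {y} ¬¬x≤y e e>0 =
  let (M , p) = cauchy x d d>0
      (N , q) = cauchy y d d>0
  in decide M N p q (seq x (M ⊔ N) ℚ.≤? seq y (M ⊔ N) ℚ.+ (d ℚ.+ d ℚ.+ d))
  where
  open ℚ.≤-Reasoning
  open +-*-Solver
  d = e ℚ.* ½ ℚ.* ½ ℚ.* ½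
  d>0 : 0ℚ ℚ.< d
  d>0 = ½*-pos (½*-pos (½*-pos e>0))
  decide : ∀ M N →
    (∀ i j → M ℕ.≤ i → M ℕ.≤ j → ℚ.∣ seq x i ℚ.- seq x j ∣ ℚ.≤ d) →
    (∀ i j → N ℕ.≤ i → N ℕ.≤ j → ℚ.∣ seq y i ℚ.- seq y j ∣ ℚ.≤ d) →
    Dec (seq x (M ⊔ N) ℚ.≤ seq y (M ⊔ N) ℚ.+ (d ℚ.+ d ℚ.+ d)) →
    ∃[ K ] (∀ i → K ℕ.≤ i → seq x i ℚ.≤ seq y i ℚ.+ e)
  decide M N p q (yes close) = M ⊔ N , λ i i≥ → begin
    seq x i
      ≤⟨ ∣-∣≤⇒≤+ {seq x i} (p i (M ⊔ N) (ℕ.m⊔n≤o⇒m≤o M N i≥) (ℕ.m≤m⊔n M N)) ⟩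
    seq x (M ⊔ N) ℚ.+ d
      ≤⟨ ℚ.+-monoˡ-≤ d close ⟩
    seq y (M ⊔ N) ℚ.+ (d ℚ.+ d ℚ.+ d) ℚ.+ d
      ≤⟨ ℚ.+-monoˡ-≤ d (ℚ.+-monoˡ-≤ (d ℚ.+ d ℚ.+ d)
           (∣-∣≤⇒≤+ {seq y (M ⊔ N)} (q (M ⊔ N) i (ℕ.m≤n⊔m M N) (ℕ.m⊔n≤o⇒n≤o M N i≥)))) ⟩
    seq y i ℚ.+ d ℚ.+ (d ℚ.+ d ℚ.+ d) ℚ.+ d
      ≤⟨ p≤p+q (ℚ.<⇒≤ (ℚ.+-mono-< (ℚ.+-mono-< d>0 d>0) d>0)) ⟩
    seq y i ℚ.+ d ℚ.+ (d ℚ.+ d ℚ.+ d) ℚ.+ d ℚ.+ (d ℚ.+ d ℚ.+ d)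
      ≡⟨ solve 2 (λ a e → let d = e :* con ½ :* con ½ :* con ½ in
           a :+ d :+ (d :+ d :+ d) :+ d :+ (d :+ d :+ d) := a :+ e) refl (seq y i) e ⟩
    seq y i ℚ.+ e ∎
  decide M N p q (no apart) = ⊥-elim (¬¬x≤y λ x≤y →
    let (K , r) = x≤y d d>0
        i = K ⊔ (M ⊔ N)
        i≥M⊔N = ℕ.m≤n⊔m K (M ⊔ N)
    in apart (begin
      seq x (M ⊔ N)
        ≤⟨ ∣-∣≤⇒≤+ {seq x (M ⊔ N)} (p (M ⊔ N) i (ℕ.m≤m⊔n M N) (ℕ.m⊔n≤o⇒m≤o M N i≥M⊔N)) ⟩
      seq x i ℚ.+ d
        ≤⟨ ℚ.+-monoˡ-≤ d (r i (ℕ.m≤m⊔n K (M ⊔ N))) ⟩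
      seq y i ℚ.+ d ℚ.+ d
        ≤⟨ ℚ.+-monoˡ-≤ d (ℚ.+-monoˡ-≤ d
             (∣-∣≤⇒≤+ {seq y i} (q i (M ⊔ N) (ℕ.m⊔n≤o⇒n≤o M N i≥M⊔N) (ℕ.m≤n⊔m M N)))) ⟩
      seq y (M ⊔ N) ℚ.+ d ℚ.+ d ℚ.+ d
        ≡⟨ solve 2 (λ a d → a :+ d :+ d :+ d := a :+ (d :+ d :+ d)) refl (seq y (M ⊔ N)) d ⟩
      seq y (M ⊔ N) ℚ.+ (d ℚ.+ d ℚ.+ d) ∎))

module ≤ℝ-Reasoning = Single _≤ℝ_ (λ {x} → ≤ℝ-refl {x}) (λ {x y z} → ≤ℝ-trans {x} {y} {z})

-- Finite sums of reals

partialSum-mono-≤ : ∀ {x y} N → (∀ k → x k ≤ℝ y k) → partialSum x N ≤ℝ partialSum y N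
partialSum-mono-≤         zero    x≤y = ≤ℝ-refl {0ℝ}
partialSum-mono-≤ {x} {y} (suc N) x≤y =
  +ℝ-mono-≤ {partialSum x N} {partialSum y N} {x N} {y N} (partialSum-mono-≤ {x} {y} N x≤y) (x≤y N)

seq-partialSum-+ : ∀ x y N i → seq (partialSum (λ k → x k +ℝ y k) N) i ≡
                               seq (partialSum x N) i ℚ.+ seq (partialSum y N) i
seq-partialSum-+ x y zero    i = refl
seq-partialSum-+ x y (suc N) i =
  trans (cong (ℚ._+ (seq (x N) i ℚ.+ seq (y N) i)) (seq-partialSum-+ x y N i))
    (solve 4 (λ a b c d → (a :+ b) :+ (c :+ d) := (a :+ c) :+ (b :+ d)) refl
      (seq (partialSum x N) i) (seq (partialSum y N) i) (seq (x N) i) (seq (y N) i))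
  where open +-*-Solver

seq-partialSum-* : ∀ c x N i → seq (partialSum (λ k → c *ℝ x k) N) i ≡
                               seq c i ℚ.* seq (partialSum x N) i
seq-partialSum-* c x zero    i = sym (ℚ.*-zeroʳ (seq c i))
seq-partialSum-* c x (suc N) i =
  trans (cong (ℚ._+ (seq c i ℚ.* seq (x N) i)) (seq-partialSum-* c x N i))
    (sym (ℚ.*-distribˡ-+ (seq c i) (seq (partialSum x N) i) (seq (x N) i)))

partialSum-stable : ∀ {x} M d → (∀ i → M ℕ.≤ i → x i ≃ℝ 0ℝ) →
                    partialSum x (d ℕ.+ M) ≃ℝ partialSum x M
partialSum-stable {x} M zero    null = ≤ℝ-refl {partialSum x M} , ≤ℝ-refl {partialSum x M}
partialSum-stable {x} M (suc d) null =
  (begin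
    partialSum x (d ℕ.+ M) +ℝ x (d ℕ.+ M)
      ∼⟨ +ℝ-mono-≤ {partialSum x (d ℕ.+ M)} {partialSum x M} {x (d ℕ.+ M)} {0ℝ}
           (proj₁ (partialSum-stable {x} M d null)) (proj₁ (null (d ℕ.+ M) (ℕ.m≤n+m M d))) ⟩
    partialSum x M +ℝ 0ℝ
      ∼⟨ pointwise-≡ {partialSum x M +ℝ 0ℝ} {partialSum x M}
           (λ i → ℚ.+-identityʳ (seq (partialSum x M) i)) ⟩
    partialSum x M ∎) ,
  (begin
    partialSum x M
      ∼⟨ pointwise-≡ {partialSum x M} {partialSum x M +ℝ 0ℝ}
           (λ i → sym (ℚ.+-identityʳ (seq (partialSum x M) i))) ⟩
    partialSum x M +ℝ 0ℝ
      ∼⟨ +ℝ-mono-≤ {partialSum x M} {partialSum x (d ℕ.+ M)} {0ℝ} {x (d ℕ.+ M)}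
           (proj₂ (partialSum-stable {x} M d null)) (proj₂ (null (d ℕ.+ M) (ℕ.m≤n+m M d))) ⟩
    partialSum x (d ℕ.+ M) +ℝ x (d ℕ.+ M) ∎)
  where open ≤ℝ-Reasoning

-- The terms of `x` may be negative although `0ℝ ≤ℝ x`, so a termwise comparison fails. Splitting
-- `n` as `m + d` leaves only the comparison of `d` copies of 0 with `d` copies of `x`.
fromℕ-*-monoˡ-≤ : ∀ {m n x} → m ℕ.≤ n → 0ℝ ≤ℝ x → fromℕ m *ℝ x ≤ℝ fromℕ n *ℝ x
fromℕ-*-monoˡ-≤ {m} {n} {x} m≤n 0≤x = begin
  fromℕ m *ℝ x
    ∼⟨ pointwise-≡ {fromℕ m *ℝ x} {fromℕ m *ℝ x +ℝ fromℕ d *ℝ 0ℝ}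
         (λ i → solve 3 (λ a b c → a :* b := a :* b :+ c :* con 0ℚ) refl (ι m) (seq x i) (ι d)) ⟩
  fromℕ m *ℝ x +ℝ fromℕ d *ℝ 0ℝ
    ∼⟨ +ℝ-mono-≤ {fromℕ m *ℝ x} {fromℕ m *ℝ x} {fromℕ d *ℝ 0ℝ} {fromℕ d *ℝ x}
         (≤ℝ-refl {fromℕ m *ℝ x}) (fromℕ-*-mono-≤ d {0ℝ} {x} 0≤x) ⟩
  fromℕ m *ℝ x +ℝ fromℕ d *ℝ x
    ∼⟨ pointwise-≡ {fromℕ m *ℝ x +ℝ fromℕ d *ℝ x} {fromℕ n *ℝ x}
         (λ i → trans (sym (ℚ.*-distribʳ-+ (seq x i) (ι m) (ι d)))
           (cong (ℚ._* seq x i) (trans (sym (ι-+ m d)) (cong ι (ℕ.m+[n∸m]≡n m≤n))))) ⟩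
  fromℕ n *ℝ x ∎
  where
  open ≤ℝ-Reasoning
  open +-*-Solver
  d = n ℕ.∸ m

T-∧⁻ : ∀ a {b} → T (a ∧ b) → T a × T b
T-∧⁻ true t = tt , t

T-∧⁺ : ∀ {a b} → T a → T b → T (a ∧ b)
T-∧⁺ {true} _ t = t

-- Expectations

module Probability {Ω : Set} (𝒫 : ProbabilitySpace Ω) where
  open ProbabilitySpace 𝒫

  Event : Set
  Event = Ω → Bool

  infixr 6 _∩_
  _∩_ : Event → Event → Event
  (A ∩ B) ω = A ω ∧ B ω

  infix 7 [_≈_]
  [_≈_] : (Ω → ℕ) → ℕ → Event
  [ X ≈ k ] = hasValue 𝒫 X k

  -- Pointwise equal events need not be equal as functions. The constant family `A` has `B` as a
  -- union, which transports measurability.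
  measurable-≗ : ∀ {A B} → (∀ ω → A ω ≡ B ω) → Measurable A → Measurable B
  measurable-≗ {A} A≗B mA = union {λ _ → A}
    (λ ω → mk⇔ (λ t → 0 , subst T (sym (A≗B ω)) t) (λ (_ , t) → subst T (A≗B ω) t)) (λ _ → mA)

  ∩-measurable : ∀ {A B} → Measurable A → Measurable B → Measurable (A ∩ B)
  ∩-measurable {A} {B} mA mB = measurable-≗ (λ ω → deMorgan (A ω) (B ω))
    (complement (union {E} {λ ω → not (A ω) ∨ not (B ω)}
      (λ ω → mk⇔ (to (A ω) (B ω) refl refl) (λ (i , t) → from i ω t)) mE))
    where
    E : ℕ → Event
    E zero    ω = not (A ω)
    E (suc _) ω = not (B ω)
    mE : ∀ i → Measurable (E i)
    mE zero    = complement mA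
    mE (suc _) = complement mB
    deMorgan : ∀ a b → not (not a ∨ not b) ≡ a ∧ b
    deMorgan true  true  = refl
    deMorgan true  false = refl
    deMorgan false _     = refl
    to : ∀ {ω} a b → A ω ≡ a → B ω ≡ b → T (not a ∨ not b) → ∃[ i ] T (E i ω)
    to false _     p q t = 0 , subst (T ∘ not) (sym p) tt
    to true  false p q t = 1 , subst (T ∘ not) (sym q) tt
    from : ∀ i ω → T (E i ω) → T (not (A ω) ∨ not (B ω))
    from zero    ω t with A ω
    ... | false = tt
    from (suc _) ω t with A ω | B ω
    ... | true  | false = tt
    ... | false | false = tt

  -- A finite partition is presented as a sequence with a null tail. The index `N + M` lies beyond
  -- both the convergence threshold and the start of the tail, so there the partial sum equals `S M`
  -- and is close to the limit.
  P-finite-union : ∀ {E F} → F IsUnionOf E → Disjoint E →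
    (mE : ∀ i → Measurable (E i)) (mF : Measurable F) →
    ∀ M → (∀ i → M ℕ.≤ i → P (E i) (mE i) ≃ℝ 0ℝ) →
    partialSum (λ i → P (E i) (mE i)) M ≃ℝ P F mF
  P-finite-union {E} {F} F=∪E disj mE mF M null =
    ≤ℝ-closed {S M} {P F mF} (λ e e>0 → let (N , conv) = limit e e>0 in begin
      S M                      ∼⟨ proj₂ (partialSum-stable {x} M N null) ⟩
      S (N ℕ.+ M)              ∼⟨ proj₁ (conv (N ℕ.+ M) (ℕ.m≤m+n N M)) ⟩
      P F mF +ℝ fromℚ e        ∎) ,
    ≤ℝ-closed {P F mF} {S M} (λ e e>0 → let (N , conv) = limit e e>0 in begin
      P F mF                   ∼⟨ proj₂ (conv (N ℕ.+ M) (ℕ.m≤m+n N M)) ⟩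
      S (N ℕ.+ M) +ℝ fromℚ e
        ∼⟨ +ℝ-mono-≤ {S (N ℕ.+ M)} {S M} {fromℚ e} {fromℚ e}
             (proj₁ (partialSum-stable {x} M N null)) (≤ℝ-refl {fromℚ e}) ⟩
      S M +ℝ fromℚ e           ∎)
    where
    open ≤ℝ-Reasoning
    x : ℕ → ℝ
    x i = P (E i) (mE i)
    S : ℕ → ℝ
    S = partialSum x
    limit = P-union F=∪E disj mE mF

  -- Besides replacing an event by a pointwise equal one, this shows that `P` does not depend on the
  -- proof of measurability.
  P-≗ : ∀ {A B} (mA : Measurable A) (mB : Measurable B) → (∀ ω → A ω ≡ B ω) → P A mA ≤ℝ P B mB
  P-≗ {A} {B} mA mB A≗B = begin
    P A mA
      ∼⟨ pointwise-≡ {P A mA} {0ℝ +ℝ P A mA} (λ i → sym (ℚ.+-identityˡ (seq (P A mA) i))) ⟩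
    0ℝ +ℝ P A mA       ∼⟨ proj₁ (P-finite-union {E} {B} cover disj mE mB 1 null) ⟩
    P B mB             ∎
    where
    open ≤ℝ-Reasoning
    E : ℕ → Event
    E zero    = A
    E (suc _) = λ _ → false
    mE : ∀ i → Measurable (E i)
    mE zero    = mA
    mE (suc _) = complement full
    cover : B IsUnionOf E
    cover ω = mk⇔ (λ t → 0 , subst T (sym (A≗B ω)) t) λ { (zero , t) → subst T (A≗B ω) t ; (suc _ , ()) }
    disj : Disjoint E
    disj zero    zero    i≢j ω _        = i≢j refl
    disj zero    (suc _) i≢j ω (_ , ())
    disj (suc _) _       i≢j ω (() , _)
    null : ∀ i → 1 ℕ.≤ i → P (E i) (mE i) ≃ℝ 0ℝ
    null (suc i) _ = P-empty (mE (suc i))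

  P-null : ∀ {A} (mA : Measurable A) → (∀ ω → ¬ T (A ω)) → P A mA ≃ℝ 0ℝ
  P-null {A} mA ¬A =
    ≤ℝ-trans {P A mA} {P∅} {0ℝ} (P-≗ mA (complement full) (λ ω → is-false (A ω) (¬A ω)))
      (proj₁ (P-empty (complement full))) ,
    P-nonneg mA
    where
    P∅ = P (λ _ → false) (complement full)
    is-false : ∀ b → ¬ T b → b ≡ false
    is-false true  ¬t = ⊥-elim (¬t tt)
    is-false false _  = refl

  -- Requiring only pointwise equality of `E k` with the intersection allows other bracketings of
  -- iterated intersections.
  P-partition : ∀ {A} {E : ℕ → Event} (mA : Measurable A) (mE : ∀ k → Measurable (E k)) →
    ∀ {X M} → (∀ ω → X ω ℕ.≤ M) → (∀ k ω → E k ω ≡ (A ∩ [ X ≈ k ]) ω) →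
    partialSum (λ k → P (E k) (mE k)) (suc M) ≃ℝ P A mA
  P-partition {A} {E} mA mE {X} {M} X≤M E≗ = P-finite-union {E} {A}
    (λ ω → mk⇔ (λ t → X ω , subst T (sym (E≗ (X ω) ω)) (T-∧⁺ t (fromWitness refl)))
                (λ (k , t) → proj₁ (split k ω t)))
    (λ i j i≢j ω (s , t) → i≢j (trans (sym (proj₂ (split i ω s))) (proj₂ (split j ω t))))
    mE mA (suc M)
    (λ i M<i → P-null (mE i) λ ω t →
      ℕ.<⇒≱ M<i (subst (ℕ._≤ M) (proj₂ (split i ω t)) (X≤M ω)))
    where
    split : ∀ k ω → T (E k ω) → T (A ω) × X ω ≡ k
    split k ω t = let (a , x) = T-∧⁻ (A ω) (subst T (E≗ k ω) t) in a , toWitness x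

  -- Expectations restricted to events

  SetFunction : Set
  SetFunction = (A : Event) → Measurable A → ℝ

  -- The property is closed under sums and natural multiples, so it passes from `P` to sums of
  -- restricted expectations. It reassembles the pieces after a split along the values of `X`.
  Superadditive : SetFunction → Set
  Superadditive F = ∀ {A} (mA : Measurable A) {X} (mX : IsRandomVariable 𝒫 X) {M} →
    (∀ ω → X ω ℕ.≤ M) →
    partialSum (λ k → F (A ∩ [ X ≈ k ]) (∩-measurable mA (mX k))) (suc M) ≤ℝ F A mA

  P∩-superadditive : ∀ {B} (mB : Measurable B) →
    Superadditive (λ A mA → P (A ∩ B) (∩-measurable mA mB))
  P∩-superadditive {B} mB {A} mA {X} mX X≤M = proj₁ (P-partition (∩-measurable mA mB)
    (λ k → ∩-measurable (∩-measurable mA (mX k)) mB) X≤M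
    (λ k ω → swap (A ω) ([ X ≈ k ] ω) (B ω)))
    where
    swap : ∀ a x b → (a ∧ x) ∧ b ≡ (a ∧ b) ∧ x
    swap false _     _     = refl
    swap true  false false = refl
    swap true  false true  = refl
    swap true  true  false = refl
    swap true  true  true  = refl

  *-superadditive : ∀ n {F} → Superadditive F → Superadditive (λ A mA → fromℕ n *ℝ F A mA)
  *-superadditive n {F} sF {A} mA {X} mX {M} X≤M = begin
    partialSum (λ k → fromℕ n *ℝ f k) (suc M)
      ∼⟨ pointwise-≡ {partialSum (λ k → fromℕ n *ℝ f k) (suc M)} {fromℕ n *ℝ partialSum f (suc M)}
           (seq-partialSum-* (fromℕ n) f (suc M)) ⟩
    fromℕ n *ℝ partialSum f (suc M)
      ∼⟨ fromℕ-*-mono-≤ n {partialSum f (suc M)} {F A mA} (sF mA mX X≤M) ⟩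
    fromℕ n *ℝ F A mA ∎
    where
    open ≤ℝ-Reasoning
    f : ℕ → ℝ
    f k = F (A ∩ [ X ≈ k ]) (∩-measurable mA (mX k))

  +-superadditive : ∀ {F G} → Superadditive F → Superadditive G →
                    Superadditive (λ A mA → F A mA +ℝ G A mA)
  +-superadditive {F} {G} sF sG {A} mA {X} mX {M} X≤M = begin
    partialSum (λ k → f k +ℝ g k) (suc M)
      ∼⟨ pointwise-≡ {partialSum (λ k → f k +ℝ g k) (suc M)} {partialSum f (suc M) +ℝ partialSum g (suc M)}
           (seq-partialSum-+ f g (suc M)) ⟩
    partialSum f (suc M) +ℝ partialSum g (suc M)
      ∼⟨ +ℝ-mono-≤ {partialSum f (suc M)} {F A mA} {partialSum g (suc M)} {G A mA}
           (sF mA mX X≤M) (sG mA mX X≤M) ⟩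
    F A mA +ℝ G A mA ∎
    where
    open ≤ℝ-Reasoning
    f g : ℕ → ℝ
    f k = F (A ∩ [ X ≈ k ]) (∩-measurable mA (mX k))
    g k = G (A ∩ [ X ≈ k ]) (∩-measurable mA (mX k))

  0-superadditive : Superadditive (λ _ _ → 0ℝ)
  0-superadditive mA mX {M} X≤M = pointwise-≡ {partialSum (λ _ → 0ℝ) (suc M)} {0ℝ} (λ i → zeros (suc M) i)
    where
    zeros : ∀ N i → seq (partialSum (λ _ → 0ℝ) N) i ≡ 0ℚ
    zeros zero    i = refl
    zeros (suc N) i = trans (ℚ.+-identityʳ _) (zeros N i)

  partialSum-superadditive : ∀ {F : ℕ → SetFunction} → (∀ k → Superadditive (F k)) →
    ∀ N → Superadditive (λ A mA → partialSum (λ k → F k A mA) N)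
  partialSum-superadditive     sF zero    = 0-superadditive
  partialSum-superadditive {F} sF (suc N) =
    +-superadditive {λ A mA → partialSum (λ k → F k A mA) N} {F N}
      (partialSum-superadditive {F} sF N) (sF N)

  -- The expectation of `X` times the indicator of `A`.
  𝔼-on : (X : Ω → ℕ) → IsRandomVariable 𝒫 X → ℕ → SetFunction
  𝔼-on X mX M A mA =
    partialSum (λ k → fromℕ k *ℝ P (A ∩ [ X ≈ k ]) (∩-measurable mA (mX k))) (suc M)

  𝔼-on-superadditive : ∀ {X} (mX : IsRandomVariable 𝒫 X) M → Superadditive (𝔼-on X mX M)
  𝔼-on-superadditive {X} mX M = partialSum-superadditive
    {λ k A mA → fromℕ k *ℝ P (A ∩ [ X ≈ k ]) (∩-measurable mA (mX k))}
    (λ k → *-superadditive k {λ A mA → P (A ∩ [ X ≈ k ]) (∩-measurable mA (mX k))}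
      (P∩-superadditive (mX k))) (suc M)

  module _ {I : Set} (X : I → Ω → ℕ) (mX : ∀ i → IsRandomVariable 𝒫 (X i))
           (M : I → ℕ) (X≤M : ∀ i ω → X i ω ℕ.≤ M i) where

    ∑𝔼-on : List I → SetFunction
    ∑𝔼-on []       A mA = 0ℝ
    ∑𝔼-on (i ∷ is) A mA = 𝔼-on (X i) (mX i) (M i) A mA +ℝ ∑𝔼-on is A mA

    ∑𝔼 : List I → ℝ
    ∑𝔼 []       = 0ℝ
    ∑𝔼 (i ∷ is) = 𝔼 𝒫 (X i) (mX i) (M i) (X≤M i) +ℝ ∑𝔼 is

    ∑𝔼-on-superadditive : ∀ is → Superadditive (∑𝔼-on is)
    ∑𝔼-on-superadditive []       = 0-superadditive
    ∑𝔼-on-superadditive (i ∷ is) = +-superadditive {𝔼-on (X i) (mX i) (M i)} {∑𝔼-on is}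
      (𝔼-on-superadditive (mX i) (M i)) (∑𝔼-on-superadditive is)

    -- The lower bound is split along the values k of the first variable:
    -- where it equals k, the others still sum to at least C ∸ k.
    ∑𝔼-on-lower : ∀ is {A} (mA : Measurable A) C →
      (∀ ω → T (A ω) → C ℕ.≤ sum (map (λ i → X i ω) is)) →
      fromℕ C *ℝ P A mA ≤ℝ ∑𝔼-on is A mA
    ∑𝔼-on-lower [] {A} mA zero    C≤ =
      pointwise-≡ {fromℕ 0 *ℝ P A mA} {0ℝ} (λ i → ℚ.*-zeroˡ (seq (P A mA) i))
    ∑𝔼-on-lower [] {A} mA (suc C) C≤ = begin
      fromℕ (suc C) *ℝ P A mA
        -- On `A` the empty sum would be at least `suc C`, so `A` is empty.
        ∼⟨ fromℕ-*-mono-≤ (suc C) {P A mA} {0ℝ} (proj₁ (P-null mA λ ω t → ℕ.n≮0 (C≤ ω t))) ⟩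
      fromℕ (suc C) *ℝ 0ℝ
        ∼⟨ pointwise-≡ {fromℕ (suc C) *ℝ 0ℝ} {0ℝ} (λ _ → ℚ.*-zeroʳ (ι (suc C))) ⟩
      0ℝ ∎
      where open ≤ℝ-Reasoning
    ∑𝔼-on-lower (i ∷ is) {A} mA C C≤ = begin
      fromℕ C *ℝ P A mA
        ∼⟨ fromℕ-*-mono-≤ C {P A mA} {partialSum p N}
             (proj₂ (P-partition mA mA∩ (X≤M i) (λ _ _ → refl))) ⟩
      fromℕ C *ℝ partialSum p N
        ∼⟨ pointwise-≡ {fromℕ C *ℝ partialSum p N} {partialSum (λ k → fromℕ C *ℝ p k) N}
             (λ j → sym (seq-partialSum-* (fromℕ C) p N j)) ⟩
      partialSum (λ k → fromℕ C *ℝ p k) N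
        ∼⟨ partialSum-mono-≤ {λ k → fromℕ C *ℝ p k} {λ k → fromℕ k *ℝ p k +ℝ r k} N cell ⟩
      partialSum (λ k → fromℕ k *ℝ p k +ℝ r k) N
        ∼⟨ pointwise-≡ {partialSum (λ k → fromℕ k *ℝ p k +ℝ r k) N} {here +ℝ partialSum r N}
             (seq-partialSum-+ (λ k → fromℕ k *ℝ p k) r N) ⟩
      here +ℝ partialSum r N
        ∼⟨ +ℝ-mono-≤ {here} {here} {partialSum r N} {∑𝔼-on is A mA}
             (≤ℝ-refl {here}) (∑𝔼-on-superadditive is mA (mX i) (X≤M i)) ⟩
      here +ℝ ∑𝔼-on is A mA ∎
      where
      open ≤ℝ-Reasoning
      N = suc (M i)
      mA∩ : ∀ k → Measurable (A ∩ [ X i ≈ k ])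
      mA∩ k = ∩-measurable mA (mX i k)
      p r : ℕ → ℝ
      p k = P (A ∩ [ X i ≈ k ]) (mA∩ k)
      r k = ∑𝔼-on is (A ∩ [ X i ≈ k ]) (mA∩ k)
      here = 𝔼-on (X i) (mX i) (M i) A mA
      rest : ∀ k ω → T ((A ∩ [ X i ≈ k ]) ω) →
             C ℕ.∸ k ℕ.≤ sum (map (λ j → X j ω) is)
      rest k ω t = let (a , x) = T-∧⁻ (A ω) t in
        ℕ.m≤n+o⇒m∸n≤o C k (subst (λ z → C ℕ.≤ z ℕ.+ _) (toWitness x) (C≤ ω a))
      cell : ∀ k → fromℕ C *ℝ p k ≤ℝ fromℕ k *ℝ p k +ℝ r k
      cell k = begin
        fromℕ C *ℝ p k
          -- Subtraction is truncated: for `k > C` the new coefficient exceeds `C`, which is fine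
          -- because probabilities are nonnegative.
          ∼⟨ fromℕ-*-monoˡ-≤ {C} {k ℕ.+ (C ℕ.∸ k)} {p k} (ℕ.m≤n+m∸n C k) (P-nonneg (mA∩ k)) ⟩
        fromℕ (k ℕ.+ (C ℕ.∸ k)) *ℝ p k
          ∼⟨ pointwise-≡ {fromℕ (k ℕ.+ (C ℕ.∸ k)) *ℝ p k} {fromℕ k *ℝ p k +ℝ fromℕ (C ℕ.∸ k) *ℝ p k}
               (λ j → trans (cong (ℚ._* seq (p k) j) (ι-+ k (C ℕ.∸ k)))
                 (ℚ.*-distribʳ-+ (seq (p k) j) (ι k) (ι (C ℕ.∸ k)))) ⟩
        fromℕ k *ℝ p k +ℝ fromℕ (C ℕ.∸ k) *ℝ p k
          ∼⟨ +ℝ-mono-≤ {fromℕ k *ℝ p k} {fromℕ k *ℝ p k} {fromℕ (C ℕ.∸ k) *ℝ p k} {r k}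
               (≤ℝ-refl {fromℕ k *ℝ p k}) (∑𝔼-on-lower is (mA∩ k) (C ℕ.∸ k) (rest k)) ⟩
        fromℕ k *ℝ p k +ℝ r k ∎

    ∑𝔼-on-full : ∀ is → ∑𝔼-on is (λ _ → true) full ≤ℝ ∑𝔼 is
    ∑𝔼-on-full []       = ≤ℝ-refl {0ℝ}
    ∑𝔼-on-full (i ∷ is) = +ℝ-mono-≤
      {𝔼-on (X i) (mX i) (M i) (λ _ → true) full} {𝔼 𝒫 (X i) (mX i) (M i) (X≤M i)}
      {∑𝔼-on is (λ _ → true) full} {∑𝔼 is}
      (partialSum-mono-≤ {λ k → fromℕ k *ℝ q k} {λ k → fromℕ k *ℝ P [ X i ≈ k ] (mX i k)} (suc (M i))
        (λ k → fromℕ-*-mono-≤ k {q k} {P [ X i ≈ k ] (mX i k)}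
          (P-≗ (∩-measurable full (mX i k)) (mX i k) (λ _ → refl))))
      (∑𝔼-on-full is)
      where
      q : ℕ → ℝ
      q k = P [ X i ≈ k ] (∩-measurable full (mX i k))

    -- The passage from deterministic to randomized algorithms: a bound valid for every `ω` survives
    -- averaging.
    ∑𝔼-lower : ∀ is C → (∀ ω → C ℕ.≤ sum (map (λ i → X i ω) is)) → fromℕ C ≤ℝ ∑𝔼 is
    ∑𝔼-lower is C C≤ = begin
      fromℕ C
        ∼⟨ pointwise-≡ {fromℕ C} {fromℕ C *ℝ 1ℝ} (λ _ → sym (ℚ.*-identityʳ (ι C))) ⟩
      fromℕ C *ℝ 1ℝ
        ∼⟨ fromℕ-*-mono-≤ C {1ℝ} {P (λ _ → true) full} (proj₂ P-full) ⟩
      fromℕ C *ℝ P (λ _ → true) full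
        ∼⟨ ∑𝔼-on-lower is full C (λ ω _ → C≤ ω) ⟩
      ∑𝔼-on is (λ _ → true) full
        ∼⟨ ∑𝔼-on-full is ⟩
      ∑𝔼 is ∎
      where open ≤ℝ-Reasoning

-- Random request sequences

-- In (e , f , w) a fair coin chooses between the edges e and f, and w is meant to
-- be a lower bound on the expected cost of reacting to it.
Request : ℕ → Set
Request n = Edge n × Edge n × ℕ

gain : ∀ {n} → List (Request n) → ℕ
gain rs = sum (map (proj₂ ∘ proj₂) rs)

-- One entry per coin sequence, with repetitions, so a plain sum over this list is `2 ^ length rs`
-- times the average over fair coins.
outcomes : ∀ {n} → List (Request n) → List (List (Edge n))
outcomes []                 = [] ∷ []
outcomes ((e , f , _) ∷ rs) = map (e ∷_) (outcomes rs) ++ map (f ∷_) (outcomes rs)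

data Outcome {n} : List (Request n) → List (Edge n) → Set where
  []   : Outcome [] []
  fst∷ : ∀ {e f w rs τ} → Outcome rs τ → Outcome ((e , f , w) ∷ rs) (e ∷ τ)
  snd∷ : ∀ {e f w rs τ} → Outcome rs τ → Outcome ((e , f , w) ∷ rs) (f ∷ τ)

outcomes-sound : ∀ {n} (rs : List (Request n)) → All (Outcome rs) (outcomes rs)
outcomes-sound []                 = [] ∷ []
outcomes-sound ((e , f , w) ∷ rs) =
  All.++⁺ (All.map⁺ (All.map fst∷ (outcomes-sound rs))) (All.map⁺ (All.map snd∷ (outcomes-sound rs)))

length-outcomes : ∀ {n} (rs : List (Request n)) → length (outcomes rs) ≡ 2 ℕ.^ length rs
length-outcomes []                 = refl
length-outcomes ((e , f , w) ∷ rs) = trans (List.length-++ (map (e ∷_) (outcomes rs)))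
  (cong₂ ℕ._+_ (half e) (trans (half f) (sym (ℕ.+-identityʳ _))))
  where
  half : ∀ g → length (map (g ∷_) (outcomes rs)) ≡ 2 ℕ.^ length rs
  half g = trans (List.length-map (g ∷_) (outcomes rs)) (length-outcomes rs)

outcome-exists : ∀ {n} (rs : List (Request n)) → ∃[ τ ] Outcome rs τ
outcome-exists []       = [] , []
outcome-exists (_ ∷ rs) = let (τ , o) = outcome-exists rs in _ , fst∷ o

outcome-++⁻ : ∀ {n} rs {rs′} {τ : List (Edge n)} → Outcome (rs ++ rs′) τ →
  ∃[ τ₁ ] ∃[ τ₂ ] τ ≡ τ₁ ++ τ₂ × Outcome rs τ₁ × Outcome rs′ τ₂
outcome-++⁻ []       o        = [] , _ , refl , [] , o
outcome-++⁻ (_ ∷ rs) (fst∷ o) =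
  let (τ₁ , τ₂ , eq , o₁ , o₂) = outcome-++⁻ rs o in _ ∷ τ₁ , τ₂ , cong (_ ∷_) eq , fst∷ o₁ , o₂
outcome-++⁻ (_ ∷ rs) (snd∷ o) =
  let (τ₁ , τ₂ , eq , o₁ , o₂) = outcome-++⁻ rs o in _ ∷ τ₁ , τ₂ , cong (_ ∷_) eq , snd∷ o₁ , o₂

take-∷ʳ : ∀ {A : Set} (xs : List A) x {t} → t ℕ.≤ length xs → take t (xs ∷ʳ x) ≡ take t xs
take-∷ʳ xs       x {zero}  _         = refl
take-∷ʳ (y ∷ xs) x {suc t} (s≤s t≤) = cong (y ∷_) (take-∷ʳ xs x t≤)

sum-map-∷ : ∀ {A : Set} (g : List A → ℕ) x xss →
            sum (map g (map (x ∷_) xss)) ≡ sum (map (g ∘ (x ∷_)) xss)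
sum-map-∷ g x xss = cong sum (sym (List.map-∘ xss))

-- Cost of a deterministic algorithm summed over the coins

module Game {n} (I : Instance n) where

  -- The coloring `c` is common to both branches because an online algorithm fixes it before the
  -- coin is revealed. An expected cost of at least `w` is written with both sides doubled.
  Costly : List (Edge n) → Request n → Set
  Costly σ (e , f , w) = ∀ c d d′ → Proper σ c → Proper (σ ∷ʳ e) d → Proper (σ ∷ʳ f) d′ →
    w ℕ.+ w ℕ.≤ recoloringCost I c d ℕ.+ recoloringCost I c d′

  Hard : List (Edge n) → List (Request n) → Set
  Hard σ []                     = ⊤
  Hard σ (r@(e , f , _) ∷ rs) = Costly σ r × Hard (σ ∷ʳ e) rs × Hard (σ ∷ʳ f) rs

  hard-++ : ∀ σ rs {rs′} → Hard σ rs → (∀ τ → Outcome rs τ → Hard (σ ++ τ) rs′) → Hard σ (rs ++ rs′)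
  hard-++ σ []       {rs′} _ h = subst (λ z → Hard z rs′) (List.++-identityʳ σ) (h [] [])
  hard-++ σ ((e , f , w) ∷ rs) {rs′} (costly , h₁ , h₂) h =
    costly ,
    hard-++ (σ ∷ʳ e) rs h₁ (λ τ o → subst (λ z → Hard z rs′) (sym (List.∷ʳ-++ σ e τ)) (h _ (fst∷ o))) ,
    hard-++ (σ ∷ʳ f) rs h₂ (λ τ o → subst (λ z → Hard z rs′) (sym (List.∷ʳ-++ σ f τ)) (h _ (snd∷ o)))

  admissible-prefix : ∀ σ {τ} → Admissible I (σ ++ τ) → Admissible I σ
  admissible-prefix σ (c , p , b) = c , All.++⁻ˡ σ p , b

  totalCost-cong : ∀ T {c d} → (∀ t → t ℕ.≤ T → c t ≡ d t) → totalCost I T c ≡ totalCost I T d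
  totalCost-cong zero    c≡d = refl
  totalCost-cong (suc T) c≡d = cong₂ ℕ._+_ (totalCost-cong T (λ t t≤T → c≡d t (ℕ.m≤n⇒m≤1+n t≤T)))
    (cong₂ (recoloringCost I) (c≡d T (ℕ.n≤1+n T)) (c≡d (suc T) ℕ.≤-refl))

  module _ {ε} (A : OnlineAlgorithm I ε) where
    open OnlineAlgorithm A

    final : List (Edge n) → Coloring n
    final σ = run I output σ (length σ)

    final-proper : ∀ σ → Admissible I σ → Proper σ (final σ)
    final-proper []        _   = []
    final-proper σ@(_ ∷ _) adm = subst (λ z → Proper z (final σ)) (List.take-all (length σ) σ ℕ.≤-refl)
      (Serves.proper (correct σ adm) (length σ) (s≤s z≤n) ℕ.≤-refl)

    -- This is where being online enters: up to time `length σ` both runs see the same prefixes.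
    cost-∷ʳ : ∀ σ e → cost I (σ ∷ʳ e) A ≡ cost I σ A ℕ.+ recoloringCost I (final σ) (final (σ ∷ʳ e))
    cost-∷ʳ σ e = by-length (trans (List.length-++ σ) (ℕ.+-comm (length σ) 1))
      where
      same : ∀ t → t ℕ.≤ length σ → run I output (σ ∷ʳ e) t ≡ run I output σ t
      same zero    _   = refl
      same (suc t) t≤ = cong output (take-∷ʳ σ e t≤)
      -- The length of `σ ∷ʳ e` is a successor only propositionally; abstracting it as `T` lets
      -- `totalCost` unfold.
      by-length : ∀ {T} → T ≡ suc (length σ) → totalCost I T (run I output (σ ∷ʳ e)) ≡
        cost I σ A ℕ.+ recoloringCost I (final σ) (run I output (σ ∷ʳ e) T)
      by-length refl = cong₂ ℕ._+_ (totalCost-cong (length σ) same)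
        (cong (λ c → recoloringCost I c (run I output (σ ∷ʳ e) (suc (length σ))))
          (same (length σ) ℕ.≤-refl))

    -- The cost already paid on `σ` is part of the bound: both branches inherit it, and by `Costly`
    -- their next steps together add at least `w + w`, the share of the two halves of the coin
    -- sequences.
    outcomes-cost : ∀ σ rs → Hard σ rs → (∀ τ → Outcome rs τ → Admissible I (σ ++ τ)) →
      2 ℕ.^ length rs ℕ.* (cost I σ A ℕ.+ gain rs) ℕ.≤
      sum (map (λ τ → cost I (σ ++ τ) A) (outcomes rs))
    outcomes-cost σ []                   _                  adm = ℕ.≤-reflexive (cong (ℕ._+ 0)
      (trans (ℕ.+-identityʳ _) (cong (λ z → cost I z A) (sym (List.++-identityʳ σ)))))
    outcomes-cost σ (r@(e , f , w) ∷ rs) (costly , h₁ , h₂) adm = begin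
      2 ℕ.* p ℕ.* (cost I σ A ℕ.+ (w ℕ.+ W))
        ≡⟨ solve 4 (λ p g w W → con 2 :* p :* (g :+ (w :+ W)) :=
             p :* ((g :+ W) :+ (g :+ W) :+ (w :+ w))) refl p (cost I σ A) w W ⟩
      p ℕ.* ((cost I σ A ℕ.+ W) ℕ.+ (cost I σ A ℕ.+ W) ℕ.+ (w ℕ.+ w))
        ≤⟨ ℕ.*-monoʳ-≤ p (ℕ.+-monoʳ-≤ ((cost I σ A ℕ.+ W) ℕ.+ (cost I σ A ℕ.+ W))
             (costly _ _ _ (final-proper σ admσ) (final-proper _ adm₁) (final-proper _ adm₂))) ⟩
      p ℕ.* ((cost I σ A ℕ.+ W) ℕ.+ (cost I σ A ℕ.+ W) ℕ.+ (a ℕ.+ b))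
        ≡⟨ solve 5 (λ p g W a b → p :* ((g :+ W) :+ (g :+ W) :+ (a :+ b)) :=
             p :* ((g :+ a) :+ W) :+ p :* ((g :+ b) :+ W)) refl p (cost I σ A) W a b ⟩
      p ℕ.* ((cost I σ A ℕ.+ a) ℕ.+ W) ℕ.+ p ℕ.* ((cost I σ A ℕ.+ b) ℕ.+ W)
        ≡⟨ cong₂ (λ x y → p ℕ.* (x ℕ.+ W) ℕ.+ p ℕ.* (y ℕ.+ W)) (sym (cost-∷ʳ σ e)) (sym (cost-∷ʳ σ f)) ⟩
      p ℕ.* (cost I (σ ∷ʳ e) A ℕ.+ W) ℕ.+ p ℕ.* (cost I (σ ∷ʳ f) A ℕ.+ W)
        ≤⟨ ℕ.+-mono-≤ (outcomes-cost (σ ∷ʳ e) rs h₁ adm₁τ) (outcomes-cost (σ ∷ʳ f) rs h₂ adm₂τ) ⟩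
      sum (map (λ τ → cost I ((σ ∷ʳ e) ++ τ) A) (outcomes rs)) ℕ.+
      sum (map (λ τ → cost I ((σ ∷ʳ f) ++ τ) A) (outcomes rs))
        ≡⟨ cong₂ ℕ._+_ (shift e) (shift f) ⟩
      sum (map g (map (e ∷_) (outcomes rs))) ℕ.+ sum (map g (map (f ∷_) (outcomes rs)))
        ≡⟨ sym (sum-++ (map g (map (e ∷_) (outcomes rs))) (map g (map (f ∷_) (outcomes rs)))) ⟩
      sum (map g (map (e ∷_) (outcomes rs)) ++ map g (map (f ∷_) (outcomes rs)))
        ≡⟨ cong sum (sym (List.map-++ g (map (e ∷_) (outcomes rs)) (map (f ∷_) (outcomes rs)))) ⟩
      sum (map g (outcomes (r ∷ rs))) ∎
      where
      open ℕ.≤-Reasoning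
      open ℕ-Solver
      p = 2 ℕ.^ length rs
      W = gain rs
      g : List (Edge n) → ℕ
      g τ = cost I (σ ++ τ) A
      a = recoloringCost I (final σ) (final (σ ∷ʳ e))
      b = recoloringCost I (final σ) (final (σ ∷ʳ f))
      adm₁τ : ∀ τ → Outcome rs τ → Admissible I ((σ ∷ʳ e) ++ τ)
      adm₁τ τ o = subst (Admissible I) (sym (List.∷ʳ-++ σ e τ)) (adm _ (fst∷ o))
      adm₂τ : ∀ τ → Outcome rs τ → Admissible I ((σ ∷ʳ f) ++ τ)
      adm₂τ τ o = subst (Admissible I) (sym (List.∷ʳ-++ σ f τ)) (adm _ (snd∷ o))
      -- Only complete outcomes are assumed admissible; any completion makes its prefixes
      -- admissible, and `correct` demands this.
      adm₁ = let (τ , o) = outcome-exists rs in admissible-prefix (σ ∷ʳ e) (adm₁τ τ o)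
      adm₂ = let (τ , o) = outcome-exists rs in admissible-prefix (σ ∷ʳ f) (adm₂τ τ o)
      admσ = admissible-prefix σ adm₁
      shift : ∀ x → sum (map (λ τ → cost I ((σ ∷ʳ x) ++ τ) A) (outcomes rs)) ≡
                    sum (map g (map (x ∷_) (outcomes rs)))
      shift x = trans
        (cong sum (List.map-cong (λ τ → cong (λ z → cost I z A) (List.∷ʳ-++ σ x τ)) (outcomes rs)))
        (sym (sum-map-∷ g x (outcomes rs)))

-- The merging adversary

∑-mono-≤ : ∀ {n} {f g : Fin n → ℕ} → (∀ i → f i ℕ.≤ g i) → ∑ f ℕ.≤ ∑ g
∑-mono-≤ {zero}  f≤g = z≤n
∑-mono-≤ {suc n} f≤g = ℕ.+-mono-≤ (f≤g zero) (∑-mono-≤ (f≤g ∘ suc))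

∑-const : ∀ {n} c → ∑ {n} (λ _ → c) ≡ n ℕ.* c
∑-const {zero}  c = refl
∑-const {suc n} c = cong (c ℕ.+_) (∑-const {n} c)

∑-splitAt : ∀ m {n} (f : Fin (m ℕ.+ n) → ℕ) → ∑ f ≡ ∑ (f ∘ (_↑ˡ n)) ℕ.+ ∑ (f ∘ (m ↑ʳ_))
∑-splitAt zero    f = refl
∑-splitAt (suc m) f = trans (cong (f zero ℕ.+_) (∑-splitAt m (f ∘ suc)))
  (sym (ℕ.+-assoc (f zero) _ _))

splitAt-elim : ∀ {m n} (Q : Fin (m ℕ.+ n) → Set) →
  (∀ i → Q (i ↑ˡ n)) → (∀ j → Q (m ↑ʳ j)) → ∀ k → Q k
splitAt-elim {m} {n} Q l r k with splitAt m k in eq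
... | inj₁ i = subst Q (Fin.splitAt⁻¹-↑ˡ eq) (l i)
... | inj₂ j = subst Q (Fin.splitAt⁻¹-↑ʳ eq) (r j)

≢-≢⇒≡ : ∀ {a b c : Color} → a ≢ b → b ≢ c → a ≡ c
≢-≢⇒≡ {zero}     {zero}               p q = ⊥-elim (p refl)
≢-≢⇒≡ {zero}     {suc zero} {zero}     p q = refl
≢-≢⇒≡ {zero}     {suc zero} {suc zero} p q = ⊥-elim (q refl)
≢-≢⇒≡ {suc zero} {zero}     {zero}     p q = ⊥-elim (q refl)
≢-≢⇒≡ {suc zero} {zero}     {suc zero} p q = refl
≢-≢⇒≡ {suc zero} {suc zero}            p q = ⊥-elim (p refl)

across : ∀ {a b a′ b′ : Color} → a ≢ b → a′ ≢ b′ → a ≡ a′ → b ≡ b′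
across a≢b a′≢b′ refl = ≢-≢⇒≡ (a≢b ∘ sym) a′≢b′

bit : Bool → Color
bit false = zero
bit true  = suc zero

bit-injective : ∀ {a b} → bit a ≡ bit b → a ≡ b
bit-injective {false} {false} _ = refl
bit-injective {true}  {true}  _ = refl

-- This is 2^j, in a form for which the indices of a block split definitionally into those of its
-- two halves.
size : ℕ → ℕ
size zero    = 1
size (suc j) = size j ℕ.+ size j

root : ∀ j → Fin (size j)
root zero    = zero
root (suc j) = root j ↑ˡ size j

-- The padded instance and its balanced colorings

module Construction (P r : ℕ) where

  Extra : Set
  Extra = Fin (suc (suc r))

  V : ℕ
  V = P ℕ.+ (P ℕ.+ suc (suc r))

  L R : Fin P → Fin V
  L p = p ↑ˡ (P ℕ.+ suc (suc r))
  R p = P ↑ʳ (p ↑ˡ suc (suc r))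

  X : Extra → Fin V
  X e = P ↑ʳ (P ↑ʳ e)

  module _ {A : Set} (f g : Fin P → A) (h : Extra → A) where

    parts : Fin V → A
    parts v = [ f , (λ u → [ g , h ]′ (splitAt P u)) ]′ (splitAt P v)

    parts-L : ∀ p → parts (L p) ≡ f p
    parts-L p = cong [ f , _ ]′ (Fin.splitAt-↑ˡ P p _)

    parts-R : ∀ p → parts (R p) ≡ g p
    parts-R p = trans (cong [ f , _ ]′ (Fin.splitAt-↑ʳ P _ (p ↑ˡ suc (suc r))))
      (cong [ g , h ]′ (Fin.splitAt-↑ˡ P p (suc (suc r))))

    parts-X : ∀ e → parts (X e) ≡ h e
    parts-X e = trans (cong [ f , _ ]′ (Fin.splitAt-↑ʳ P _ (P ↑ʳ e)))
      (cong [ g , h ]′ (Fin.splitAt-↑ʳ P (suc (suc r)) e))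

    parts-all : (Q : A → Set) → (∀ p → Q (f p)) → (∀ p → Q (g p)) → (∀ e → Q (h e)) → ∀ v → Q (parts v)
    parts-all Q qf qg qh v with splitAt P v
    ... | inj₁ p = qf p
    ... | inj₂ u with splitAt P u
    ...   | inj₁ p = qg p
    ...   | inj₂ e = qh e

  ∑-parts : (F : Fin V → ℕ) → ∑ F ≡ ∑ (F ∘ L) ℕ.+ (∑ (F ∘ R) ℕ.+ ∑ (F ∘ X))
  ∑-parts F = trans (∑-splitAt P F) (cong (∑ (F ∘ L) ℕ.+_) (∑-splitAt P (F ∘ (P ↑ʳ_))))

  -- The extra vertices only pad the instance to the required number of vertices.
  -- One of them balances all the others, whatever the parity of their number.
  extraWeight : Extra → ℕ
  extraWeight zero    = suc r
  extraWeight (suc _) = 1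

  extraColor : Extra → Color
  extraColor zero    = zero
  extraColor (suc _) = suc zero

  weight : Fin V → ℕ
  weight = parts (λ _ → 1) (λ _ → 1) extraWeight

  coloring : (Fin P → Bool) → Coloring V
  coloring x = parts (bit ∘ x) (bit ∘ not ∘ x) extraColor

  weight-L : ∀ p → weight (L p) ≡ 1
  weight-L = parts-L (λ _ → 1) (λ _ → 1) extraWeight

  weight-R : ∀ p → weight (R p) ≡ 1
  weight-R = parts-R (λ _ → 1) (λ _ → 1) extraWeight

  weight-X : ∀ e → weight (X e) ≡ extraWeight e
  weight-X = parts-X (λ _ → 1) (λ _ → 1) extraWeight

  coloring-L : ∀ x p → coloring x (L p) ≡ bit (x p)
  coloring-L x = parts-L (bit ∘ x) (bit ∘ not ∘ x) extraColor

  coloring-R : ∀ x p → coloring x (R p) ≡ bit (not (x p))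
  coloring-R x = parts-R (bit ∘ x) (bit ∘ not ∘ x) extraColor

  coloring-X : ∀ x e → coloring x (X e) ≡ extraColor e
  coloring-X x = parts-X (bit ∘ x) (bit ∘ not ∘ x) extraColor

  ∑-1 : ∀ n → ∑ {n} (λ _ → 1) ≡ n
  ∑-1 n = trans (∑-const {n} 1) (ℕ.*-identityʳ n)

  ∑-0 : ∀ n → ∑ {n} (λ _ → 0) ≡ 0
  ∑-0 n = trans (∑-const {n} 0) (ℕ.*-zeroʳ n)

  ∑-weight : ∑ weight ≡ (P ℕ.+ suc r) ℕ.* 2
  ∑-weight = trans (∑-parts weight) (trans
    (cong₂ ℕ._+_ (trans (sum-cong-≗ weight-L) (∑-1 P))
      (cong₂ ℕ._+_ (trans (sum-cong-≗ weight-R) (∑-1 P))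
        (trans (sum-cong-≗ weight-X) (cong (suc r ℕ.+_) (∑-1 (suc r))))))
    (solve 2 (λ p s → p :+ (p :+ (s :+ s)) := (p :+ s) :* con 2) refl P (suc r)))
    where open ℕ-Solver

  half-∑-weight : ∑ weight / 2 ≡ P ℕ.+ suc r
  half-∑-weight = trans (cong (_/ 2) ∑-weight) (m*n/n≡m (P ℕ.+ suc r) 2)

  -- Each pair gives weight 1 to each color, and the extra vertices give `suc r` to each,
  -- independently of `x`.
  coloring-balanced : ∀ x k → classWeight weight (coloring x) k ≡ P ℕ.+ suc r
  coloring-balanced x k = trans (∑-parts F) (trans
    (sym (ℕ.+-assoc (∑ (F ∘ L)) (∑ (F ∘ R)) (∑ (F ∘ X))))
    (cong₂ ℕ._+_
      (trans (sym (∑-distrib-+ (F ∘ L) (F ∘ R)))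
        (trans (sum-cong-≗ pair) (∑-1 P)))
      (trans (sum-cong-≗ (λ e → cong₂ (λ c w → if ⌊ c Fin.≟ k ⌋ then w else 0) (coloring-X x e) (weight-X e)))
        (extra k))))
    where
    F : Fin V → ℕ
    F v = if ⌊ coloring x v Fin.≟ k ⌋ then weight v else 0
    one : ∀ b k → (if ⌊ bit b Fin.≟ k ⌋ then 1 else 0) ℕ.+ (if ⌊ bit (not b) Fin.≟ k ⌋ then 1 else 0) ≡ 1
    one false zero       = refl
    one false (suc zero) = refl
    one true  zero       = refl
    one true  (suc zero) = refl
    pair : ∀ p → F (L p) ℕ.+ F (R p) ≡ 1
    pair p = trans (cong₂ ℕ._+_
      (cong₂ (λ c w → if ⌊ c Fin.≟ k ⌋ then w else 0) (coloring-L x p) (weight-L p))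
      (cong₂ (λ c w → if ⌊ c Fin.≟ k ⌋ then w else 0) (coloring-R x p) (weight-R p)))
      (one (x p) k)
    extra : ∀ k → ∑ (λ e → if ⌊ extraColor e Fin.≟ k ⌋ then extraWeight e else 0) ≡ suc r
    extra zero       = trans (cong (suc r ℕ.+_) (∑-0 (suc r))) (ℕ.+-identityʳ (suc r))
    extra (suc zero) = ∑-1 (suc r)

  inst : Instance V
  inst = record
    { w           = weight
    ; w-positive  = parts-all (λ _ → 1) (λ _ → 1) extraWeight (0 ℕ.<_)
                      (λ _ → s≤s z≤n) (λ _ → s≤s z≤n) λ { zero → s≤s z≤n ; (suc _) → s≤s z≤n }
    ; total-even  = divides (P ℕ.+ suc r) ∑-weight
    ; w≤B         = λ v → subst (weight v ℕ.≤_) (sym half-∑-weight) (weight≤ v)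
    ; c₀          = coloring (λ _ → false)
    ; c₀-balanced = λ k → ℕ.≤-reflexive (trans (coloring-balanced _ k) (sym half-∑-weight))
    }
    where
    1≤ : 1 ℕ.≤ P ℕ.+ suc r
    1≤ = ℕ.≤-trans (s≤s z≤n) (ℕ.m≤n+m (suc r) P)
    weight≤ : ∀ v → weight v ℕ.≤ P ℕ.+ suc r
    weight≤ = parts-all (λ _ → 1) (λ _ → 1) extraWeight (ℕ._≤ P ℕ.+ suc r)
      (λ _ → 1≤) (λ _ → 1≤) λ { zero → ℕ.m≤n+m (suc r) P ; (suc _) → 1≤ }

  coloring-within : ∀ x → WithinCapacity inst (fromℕ (Instance.B inst)) (coloring x)
  coloring-within x k = pointwise-≤ {fromℕ (classWeight weight (coloring x) k)} {fromℕ (Instance.B inst)}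
    (λ _ → ι-mono-≤ (ℕ.≤-reflexive (trans (coloring-balanced x k) (sym half-∑-weight))))

  -- The extra vertices have the same color in all these colorings, so only the `P + P` unit weights
  -- can be paid.
  recoloring-≤ : ∀ x y → recoloringCost inst (coloring x) (coloring y) ℕ.≤ P ℕ.+ P
  recoloring-≤ x y = begin
    ∑ F                                       ≡⟨ ∑-parts F ⟩
    ∑ (F ∘ L) ℕ.+ (∑ (F ∘ R) ℕ.+ ∑ (F ∘ X))
      ≤⟨ ℕ.+-mono-≤ (∑-mono-≤ (λ p → subst (F (L p) ℕ.≤_) (weight-L p) (F≤ (L p))))
           (ℕ.+-mono-≤ (∑-mono-≤ (λ p → subst (F (R p) ℕ.≤_) (weight-R p) (F≤ (R p))))
             (ℕ.≤-reflexive (sum-cong-≗ F-X))) ⟩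
    ∑ {P} (λ _ → 1) ℕ.+ (∑ {P} (λ _ → 1) ℕ.+ ∑ {suc (suc r)} (λ _ → 0))
      ≡⟨ cong₂ ℕ._+_ (∑-1 P) (trans (cong₂ ℕ._+_ (∑-1 P) (∑-0 (suc (suc r)))) (ℕ.+-identityʳ P)) ⟩
    P ℕ.+ P ∎
    where
    open ℕ.≤-Reasoning
    F : Fin V → ℕ
    F v = if ⌊ coloring x v Fin.≟ coloring y v ⌋ then 0 else weight v
    F≤ : ∀ v → F v ℕ.≤ weight v
    F≤ v with ⌊ coloring x v Fin.≟ coloring y v ⌋
    ... | true  = z≤n
    ... | false = ℕ.≤-refl
    F-X : ∀ e → F (X e) ≡ 0
    F-X e with coloring x (X e) Fin.≟ coloring y (X e)
    ... | yes _ = refl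
    ... | no  neq = ⊥-elim (neq (trans (coloring-X x e) (sym (coloring-X y e))))

  recoloring-self : ∀ {n} (I : Instance n) c → recoloringCost I c c ≡ 0
  recoloring-self {n} I c = trans (sum-cong-≗ zeros) (∑-0 n)
    where
    zeros : ∀ v → (if ⌊ c v Fin.≟ c v ⌋ then 0 else Instance.w I v) ≡ 0
    zeros v with c v Fin.≟ c v
    ... | yes _ = refl
    ... | no  neq = ⊥-elim (neq refl)

  -- An offline strategy that recolors only at the first request

  offline : (Fin P → Bool) → ℕ → Coloring V
  offline x zero    = Instance.c₀ inst
  offline x (suc _) = coloring x

  offline-serves : ∀ x {σ} → Proper σ (coloring x) → Serves inst (fromℕ (Instance.B inst)) σ (offline x)
  offline-serves x {σ} p = record
    { initial  = λ _ → refl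
    ; proper   = λ { (suc t) _ _ → All.take⁺ (suc t) p }
    ; capacity = λ { (suc t) _ _ → coloring-within x }
    }

  offline-cost : ∀ x T → totalCost inst T (offline x) ℕ.≤ P ℕ.+ P
  offline-cost x zero          = z≤n
  offline-cost x (suc zero)    = recoloring-≤ (λ _ → false) x
  offline-cost x (suc (suc T)) = subst (ℕ._≤ P ℕ.+ P)
    (sym (trans (cong (totalCost inst (suc T) (offline x) ℕ.+_) (recoloring-self inst (coloring x)))
      (ℕ.+-identityʳ _))) (offline-cost x (suc T))

  -- The tree of merge requests

  merge : Fin P → Fin P → ℕ → Request V
  merge p q w = (L p , L q) , (L p , R q) , w

  -- `at` places the pairs of the block among all pairs. A pair request offers the same edge twice
  -- with value 0, so it fits the coin format. A merged half has `size j` pairs, hence weight twice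
  -- `size j`; losing it with probability one half gives the value `size j`.
  block : ∀ j → (Fin (size j) → Fin P) → List (Request V)
  block zero    at = ((L (at zero) , R (at zero)) , (L (at zero) , R (at zero)) , 0) ∷ []
  block (suc j) at =
    block j (at ∘ (_↑ˡ size j)) ++ (block j (at ∘ (size j ↑ʳ_)) ++
      merge (at (root j ↑ˡ size j)) (at (size j ↑ʳ root j)) (size j) ∷ [])

  -- Rigidity of the components

  Agree Differ : ∀ {m} → (Fin m → Fin P) → Coloring V → Coloring V → Set
  Agree  at c d = ∀ i → c (L (at i)) ≡ d (L (at i)) × c (R (at i)) ≡ d (R (at i))
  Differ at c d = ∀ i → c (L (at i)) ≢ d (L (at i)) × c (R (at i)) ≢ d (R (at i))

  -- Graph connectivity, expressed through proper colorings.
  record Connected {m} (at : Fin m → Fin P) (σ : List (Edge V)) : Set where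
    field
      paired : ∀ c → Proper σ c → ∀ i → c (L (at i)) ≢ c (R (at i))
      rigid  : ∀ c d → Proper σ c → Proper σ d → Agree at c d ⊎ Differ at c d

  open Connected

  Joins : ∀ {m n} → (Fin m → Fin P) → Fin m → (Fin n → Fin P) → Fin n → Edge V → Set
  Joins at p at′ q (u , v) = u ≡ L (at p) × (v ≡ L (at′ q) ⊎ v ≡ R (at′ q))

  agree-at : ∀ {n} {at : Fin n → Fin P} {q v c d} → v ≡ L (at q) ⊎ v ≡ R (at q) →
             Agree at c d → c v ≡ d v
  agree-at {q = q} (inj₁ refl) a = proj₁ (a q)
  agree-at {q = q} (inj₂ refl) a = proj₂ (a q)

  differ-at : ∀ {n} {at : Fin n → Fin P} {q v c d} → v ≡ L (at q) ⊎ v ≡ R (at q) →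
              Differ at c d → c v ≢ d v
  differ-at {q = q} (inj₁ refl) a = proj₁ (a q)
  differ-at {q = q} (inj₂ refl) a = proj₂ (a q)

  -- With two colors, the joining edge transfers agreement of `c` and `d` from one end to the other.
  -- They therefore cannot agree on one half and differ on the other.
  connected-join : ∀ {m n} {at : Fin (m ℕ.+ n) → Fin P} {p q τ₁ τ₂ e} →
    Connected (at ∘ (_↑ˡ n)) τ₁ → Connected (at ∘ (m ↑ʳ_)) τ₂ →
    Joins (at ∘ (_↑ˡ n)) p (at ∘ (m ↑ʳ_)) q e →
    Connected at (τ₁ ++ (τ₂ ++ e ∷ []))
  connected-join {m} {n} {at} {p} {q} {τ₁} {τ₂} {u , v} C₁ C₂ (refl , v∈) = record
    { paired = λ c pr → splitAt-elim (λ k → c (L (at k)) ≢ c (R (at k)))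
        (paired C₁ c (on₁ pr)) (paired C₂ c (on₂ pr))
    ; rigid = λ c d pc pd → combine (on₃ pc) (on₃ pd)
        (rigid C₁ c d (on₁ pc) (on₁ pd)) (rigid C₂ c d (on₂ pc) (on₂ pd))
    }
    where
    on₁ : ∀ {c} → Proper (τ₁ ++ (τ₂ ++ (u , v) ∷ [])) c → Proper τ₁ c
    on₁ = All.++⁻ˡ τ₁
    on₂ : ∀ {c} → Proper (τ₁ ++ (τ₂ ++ (u , v) ∷ [])) c → Proper τ₂ c
    on₂ pr = All.++⁻ˡ τ₂ (All.++⁻ʳ τ₁ pr)
    on₃ : ∀ {c} → Proper (τ₁ ++ (τ₂ ++ (u , v) ∷ [])) c → c u ≢ c v
    on₃ pr = proj₂ (All.∷ʳ⁻ (All.++⁻ʳ τ₁ pr))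
    combine : ∀ {c d} → c u ≢ c v → d u ≢ d v →
      Agree (at ∘ (_↑ˡ n)) c d ⊎ Differ (at ∘ (_↑ˡ n)) c d →
      Agree (at ∘ (m ↑ʳ_)) c d ⊎ Differ (at ∘ (m ↑ʳ_)) c d →
      Agree at c d ⊎ Differ at c d
    combine _ _ (inj₁ a₁) (inj₁ a₂) = inj₁ (splitAt-elim _ a₁ a₂)
    combine _ _ (inj₂ d₁) (inj₂ d₂) = inj₂ (splitAt-elim _ d₁ d₂)
    combine {c} {d} pc pd (inj₁ a₁) (inj₂ d₂) = ⊥-elim
      (differ-at {c = c} {d} v∈ d₂ (across pc pd (proj₁ (a₁ p))))
    combine {c} {d} pc pd (inj₂ d₁) (inj₁ a₂) = ⊥-elim
      (proj₁ (d₁ p) (across (pc ∘ sym) (pd ∘ sym) (agree-at {c = c} {d} v∈ a₂)))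

  block-connected : ∀ j {at τ} → Outcome (block j at) τ → Connected at τ
  block-connected zero {at} {τ} o = pair-connected (pair o)
    where
    e : Edge V
    e = L (at zero) , R (at zero)
    pair : ∀ {τ} → Outcome (block zero at) τ → τ ≡ e ∷ []
    pair (fst∷ []) = refl
    pair (snd∷ []) = refl
    pair-connected : ∀ {τ} → τ ≡ e ∷ [] → Connected at τ
    pair-connected refl = record
      { paired = λ { c (p ∷ []) zero → p }
      ; rigid  = λ { c d (p ∷ []) (q ∷ []) → decide c d p q } }
      where
      decide : ∀ c d → c (L (at zero)) ≢ c (R (at zero)) → d (L (at zero)) ≢ d (R (at zero)) →
               Agree at c d ⊎ Differ at c d
      decide c d p q with c (L (at zero)) Fin.≟ d (L (at zero))
      ... | yes eq = inj₁ λ { zero → eq , across p q eq }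
      ... | no  neq  = inj₂ λ { zero → neq , λ eq → neq (across (p ∘ sym) (q ∘ sym) eq) }
  block-connected (suc j) {at} o with outcome-++⁻ (block j (at ∘ (_↑ˡ size j))) o
  ... | τ₁ , _ , refl , o₁ , o′ with outcome-++⁻ (block j (at ∘ (size j ↑ʳ_))) o′
  ...   | τ₂ , _ , refl , o₂ , fst∷ [] = connected-join {p = root j} {root j}
          (block-connected j o₁) (block-connected j o₂) (refl , inj₁ refl)
  ...   | τ₂ , _ , refl , o₂ , snd∷ [] = connected-join {p = root j} {root j}
          (block-connected j o₁) (block-connected j o₂) (refl , inj₂ refl)

  -- The cost forced by a merge

  -- Injectivity of `at` in the form that a cost estimate uses: distinct positions contribute
  -- distinct summands. Restriction to a half only drops nonnegative summands.
  Embeds : ∀ {m} → (Fin m → Fin P) → Set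
  Embeds at = ∀ (f : Fin P → ℕ) → ∑ (f ∘ at) ℕ.≤ ∑ f

  embeds-↑ˡ : ∀ {m n} {at : Fin (m ℕ.+ n) → Fin P} → Embeds at → Embeds (at ∘ (_↑ˡ n))
  embeds-↑ˡ {m} {n} {at} emb f = ℕ.≤-trans (ℕ.m≤m+n _ _)
    (subst (ℕ._≤ ∑ f) (∑-splitAt m (f ∘ at)) (emb f))

  embeds-↑ʳ : ∀ {m n} {at : Fin (m ℕ.+ n) → Fin P} → Embeds at → Embeds (at ∘ (m ↑ʳ_))
  embeds-↑ʳ {m} {n} {at} emb f = ℕ.≤-trans (ℕ.m≤n+m _ _)
    (subst (ℕ._≤ ∑ f) (∑-splitAt m (f ∘ at)) (emb f))

  differ-cost : ∀ {m} {at : Fin m → Fin P} {c d} → Embeds at → Differ at c d →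
                m ℕ.+ m ℕ.≤ recoloringCost inst c d
  differ-cost {m} {at} {c} {d} emb diff = begin
    m ℕ.+ m
      ≡⟨ cong₂ ℕ._+_ (side L weight-L (proj₁ ∘ diff)) (side R weight-R (proj₂ ∘ diff)) ⟩
    ∑ (F ∘ L ∘ at) ℕ.+ ∑ (F ∘ R ∘ at)        ≤⟨ ℕ.+-mono-≤ (emb (F ∘ L)) (emb (F ∘ R)) ⟩
    ∑ (F ∘ L) ℕ.+ ∑ (F ∘ R)                  ≤⟨ ℕ.+-monoʳ-≤ (∑ (F ∘ L)) (ℕ.m≤m+n _ _) ⟩
    ∑ (F ∘ L) ℕ.+ (∑ (F ∘ R) ℕ.+ ∑ (F ∘ X))  ≡⟨ sym (∑-parts F) ⟩
    ∑ F ∎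
    where
    open ℕ.≤-Reasoning
    F : Fin V → ℕ
    F v = if ⌊ c v Fin.≟ d v ⌋ then 0 else weight v
    moved : ∀ v → c v ≢ d v → F v ≡ weight v
    moved v c≢d with c v Fin.≟ d v
    ... | yes eq = ⊥-elim (c≢d eq)
    ... | no  _  = refl
    side : (S : Fin P → Fin V) → (∀ p → weight (S p) ≡ 1) →
           (∀ i → c (S (at i)) ≢ d (S (at i))) → m ≡ ∑ (F ∘ S ∘ at)
    side S w≡1 c≢d = sym (trans
      (sum-cong-≗ (λ i → trans (moved (S (at i)) (c≢d i)) (w≡1 (at i)))) (∑-1 m))

  open Game inst

  -- Under `c` the vertices `L (at₂ q)` and `R (at₂ q)` carry both colors, so one of the two offered
  -- edges is monochromatic. A coloring proper for that edge cannot agree with `c` on both blocks,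
  -- and rigidity turns this into a complete change of one block. The other branch is bounded by
  -- zero.
  merge-costly : ∀ {m} {at₁ at₂ : Fin m → Fin P} {p q σ} → Embeds at₁ → Embeds at₂ →
    (∀ c → Proper σ c → c (L (at₂ q)) ≢ c (R (at₂ q))) →
    (∀ c d → Proper σ c → Proper σ d → Agree at₁ c d ⊎ Differ at₁ c d) →
    (∀ c d → Proper σ c → Proper σ d → Agree at₂ c d ⊎ Differ at₂ c d) →
    Costly σ (merge (at₁ p) (at₂ q) m)
  merge-costly {m} {at₁} {at₂} {p} {q} {σ} emb₁ emb₂ pair₂ rigid₁ rigid₂ c d d′ pc pd pd′ =
    decide (c (L (at₁ p)) Fin.≟ c (L (at₂ q)))
    where
    forced : ∀ v → v ≡ L (at₂ q) ⊎ v ≡ R (at₂ q) → ∀ d → Proper (σ ∷ʳ (L (at₁ p) , v)) d →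
             c (L (at₁ p)) ≡ c v → m ℕ.+ m ℕ.≤ recoloringCost inst c d
    forced v v∈ d pd cu≡cv with All.∷ʳ⁻ pd
    ... | pσ , du≢dv with rigid₁ c d pc pσ | rigid₂ c d pc pσ
    ...   | inj₂ diff | _         = differ-cost {at = at₁} {c} {d} emb₁ diff
    ...   | inj₁ _    | inj₂ diff = differ-cost {at = at₂} {c} {d} emb₂ diff
    ...   | inj₁ a₁   | inj₁ a₂   = ⊥-elim (du≢dv
            (trans (sym (proj₁ (a₁ p))) (trans cu≡cv (agree-at {c = c} {d} v∈ a₂))))
    decide : _ → _
    decide (yes eq) = ℕ.≤-trans (forced (L (at₂ q)) (inj₁ refl) d pd eq) (ℕ.m≤m+n _ _)
    decide (no neq) =
      ℕ.≤-trans (forced (R (at₂ q)) (inj₂ refl) d′ pd′ (≢-≢⇒≡ neq (pair₂ c pc))) (ℕ.m≤n+m _ _)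

  -- The history `σ` is arbitrary: connectivity of a half comes from its own requests, and further
  -- edges only shrink the set of proper colorings.
  block-hard : ∀ j {at} → Embeds at → ∀ σ → Hard σ (block j at)
  block-hard zero    emb σ = (λ _ _ _ _ _ _ → z≤n) , tt , tt
  block-hard (suc j) {at} emb σ =
    hard-++ σ (block j at₁) (block-hard j emb₁ σ) λ τ₁ o₁ →
    hard-++ (σ ++ τ₁) (block j at₂) (block-hard j emb₂ (σ ++ τ₁)) λ τ₂ o₂ →
    let C₁ = block-connected j o₁
        C₂ = block-connected j o₂
        on₁ : ∀ {c} → Proper ((σ ++ τ₁) ++ τ₂) c → Proper τ₁ c
        on₁ pr = All.++⁻ʳ σ (All.++⁻ˡ (σ ++ τ₁) pr)
        on₂ : ∀ {c} → Proper ((σ ++ τ₁) ++ τ₂) c → Proper τ₂ c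
        on₂ pr = All.++⁻ʳ (σ ++ τ₁) pr
    in merge-costly {at₁ = at₁} {at₂} {root j} {root j} emb₁ emb₂
         (λ c pc → paired C₂ c (on₂ pc) (root j))
         (λ c d pc pd → rigid C₁ c d (on₁ pc) (on₁ pd))
         (λ c d pc pd → rigid C₂ c d (on₂ pc) (on₂ pd)) , tt , tt
    where
    at₁ = at ∘ (_↑ˡ size j)
    at₂ = at ∘ (size j ↑ʳ_)
    emb₁ : Embeds at₁
    emb₁ = embeds-↑ˡ {size j} {size j} {at} emb
    emb₂ : Embeds at₂
    emb₂ = embeds-↑ʳ {size j} {size j} {at} emb

  gain-++ : ∀ (rs rs′ : List (Request V)) → gain (rs ++ rs′) ≡ gain rs ℕ.+ gain rs′
  gain-++ rs rs′ = trans (cong sum (List.map-++ (proj₂ ∘ proj₂) rs rs′)) (sum-++ (map (proj₂ ∘ proj₂) rs) _)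

  -- Each of the `j` merge levels contributes half of `size j`, as the number of merges halves from
  -- level to level while their value doubles.
  block-gain : ∀ j at → 2 ℕ.* gain (block j at) ≡ j ℕ.* size j
  block-gain zero    at = refl
  block-gain (suc j) at = trans
    (cong (2 ℕ.*_) (trans (gain-++ (block j at₁) _) (cong (gain (block j at₁) ℕ.+_) (gain-++ (block j at₂) _))))
    (trans (solve 3 (λ a b s → con 2 :* (a :+ (b :+ (s :+ con 0))) := con 2 :* a :+ con 2 :* b :+ con 2 :* s)
             refl (gain (block j at₁)) (gain (block j at₂)) (size j))
      (trans (cong₂ (λ a b → a ℕ.+ b ℕ.+ 2 ℕ.* size j) (block-gain j at₁) (block-gain j at₂))
        (solve 2 (λ j s → j :* s :+ j :* s :+ con 2 :* s := (con 1 :+ j) :* (s :+ s)) refl j (size j))))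
    where
    open ℕ-Solver
    at₁ = at ∘ (_↑ˡ size j)
    at₂ = at ∘ (size j ↑ʳ_)

  -- s accounts for the two proper colorings y and its complement of a block.
  block-solvable : ∀ j {at τ} → Outcome (block j at) τ → Σ[ y ∈ (Fin (size j) → Bool) ]
    (∀ s x → (∀ i → x (at i) ≡ s xor y i) → Proper τ (coloring x))
  block-solvable zero {at} o = (λ _ → false) , λ s x _ → proper o x
    where
    L≢R : ∀ x → coloring x (L (at zero)) ≢ coloring x (R (at zero))
    L≢R x eq = Bool.not-¬ refl (bit-injective {x (at zero)} {not (x (at zero))}
      (trans (sym (coloring-L x (at zero))) (trans eq (coloring-R x (at zero)))))
    proper : ∀ {τ} → Outcome (block zero at) τ → ∀ x → Proper τ (coloring x)
    proper (fst∷ []) x = L≢R x ∷ []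
    proper (snd∷ []) x = L≢R x ∷ []
  block-solvable (suc j) {at} o with outcome-++⁻ (block j (at ∘ (_↑ˡ size j))) o
  ... | τ₁ , _ , refl , o₁ , o′ with outcome-++⁻ (block j (at ∘ (size j ↑ʳ_))) o′
  ...   | τ₂ , _ , refl , o₂ , o₃ = y o₃ , λ s x x≡ → All.++⁺ (proj₂ S₁ s x (left o₃ s x x≡))
          (All.++⁺ (proj₂ S₂ (s xor flip o₃) x (λ i → trans (right o₃ s x x≡ i)
              (sym (Bool.xor-assoc s (flip o₃) (y₂ i)))))
            (last o₃ s x (left o₃ s x x≡ (root j)) (right o₃ s x x≡ (root j))))
    where
    S₁ = block-solvable j o₁
    S₂ = block-solvable j o₂
    y₁ = proj₁ S₁
    y₂ = proj₁ S₂
    p = at (root j ↑ˡ size j)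
    q = at (size j ↑ʳ root j)
    M = merge p q (size j) ∷ []
    a = y₁ (root j)
    b = y₂ (root j)
    -- The right half is complemented exactly when the last edge demands it: the first edge needs
    -- `L p` and `L q` to differ, the second needs them equal, since `R q` is opposite to `L q`.
    flip : ∀ {τ} → Outcome M τ → Bool
    flip (fst∷ _) = not (a xor b)
    flip (snd∷ _) = a xor b
    y : ∀ {τ} → Outcome M τ → Fin (size (suc j)) → Bool
    y o = [ y₁ , (λ i → flip o xor y₂ i) ]′ ∘ splitAt (size j)
    left : ∀ {τ} (o : Outcome M τ) s x → (∀ i → x (at i) ≡ s xor y o i) →
           ∀ i → x (at (i ↑ˡ size j)) ≡ s xor y₁ i
    left o s x x≡ i = trans (x≡ (i ↑ˡ size j))
      (cong (λ z → s xor [ y₁ , _ ]′ z) (Fin.splitAt-↑ˡ (size j) i (size j)))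
    right : ∀ {τ} (o : Outcome M τ) s x → (∀ i → x (at i) ≡ s xor y o i) →
            ∀ i → x (at (size j ↑ʳ i)) ≡ s xor (flip o xor y₂ i)
    right o s x x≡ i = trans (x≡ (size j ↑ʳ i))
      (cong (λ z → s xor [ y₁ , _ ]′ z) (Fin.splitAt-↑ʳ (size j) (size j) i))
    flipped : ∀ s a b → s xor (not (a xor b) xor b) ≡ not (s xor a)
    flipped false false false = refl
    flipped false false true  = refl
    flipped false true  false = refl
    flipped false true  true  = refl
    flipped true  false false = refl
    flipped true  false true  = refl
    flipped true  true  false = refl
    flipped true  true  true  = refl
    same : ∀ s a b → s xor ((a xor b) xor b) ≡ s xor a
    same s a b = cong (s xor_) (trans (Bool.xor-assoc a b b)
      (trans (cong (a xor_) (Bool.xor-same b)) (Bool.xor-identityʳ a)))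
    last : ∀ {τ} (o : Outcome M τ) s x → x p ≡ s xor a → x q ≡ s xor (flip o xor b) →
           Proper τ (coloring x)
    last (fst∷ []) s x xp xq = (λ eq → Bool.not-¬ refl (bit-injective {s xor a} {not (s xor a)}
      (trans (cong bit (sym xp)) (trans (sym (coloring-L x p)) (trans eq
        (trans (coloring-L x q) (cong bit (trans xq (flipped s a b))))))))) ∷ []
    last (snd∷ []) s x xp xq = (λ eq → Bool.not-¬ refl (bit-injective {s xor a} {not (s xor a)}
      (trans (cong bit (sym xp)) (trans (sym (coloring-L x p)) (trans eq
        (trans (coloring-R x q) (cong (bit ∘ not) (trans xq (same s a b))))))))) ∷ []

-- The lower bound

fraction-≤-ι : ∀ a b m → a ≤ m ℕ.* suc b → + a ℚ./ suc b ℚ.≤ ι m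
fraction-≤-ι a b m a≤ = ℚ.toℚᵘ-cancel-≤ (begin
  ℚ.toℚᵘ (+ a ℚ./ suc b)   ≃⟨ ℚ.toℚᵘ-fromℚᵘ (ℚᵘ.mkℚᵘ (+ a) b) ⟩
  ℚᵘ.mkℚᵘ (+ a) b          ≤⟨ ℚᵘ.*≤* (subst₂ ℤ._≤_ (sym (ℤ.*-identityʳ (+ a))) (ℤ.pos-* m (suc b)) (ℤ.+≤+ a≤)) ⟩
  ℚᵘ.mkℚᵘ (+ m) 0          ≃⟨ ℚᵘ.≃-sym (ℚ.toℚᵘ-fromℚᵘ (ℚᵘ.mkℚᵘ (+ m) 0)) ⟩
  ℚ.toℚᵘ (ι m)             ∎)
  where open ℚᵘ.≤-Reasoning

log₂-seq-≤ : ∀ n m → n ≤ 2 ℕ.^ m → ∀ i → log₂-seq n i ℚ.≤ ι m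
log₂-seq-≤ n m n≤2^m i = fraction-≤-ι ⌊log₂ (n ℕ.^ suc i) ⌋ i m (begin
  ⌊log₂ (n ℕ.^ suc i) ⌋             ≤⟨ ⌊log₂⌋-mono-≤ {n ℕ.^ suc i} {(2 ℕ.^ m) ℕ.^ suc i} (ℕ.^-monoˡ-≤ (suc i) n≤2^m) ⟩
  ⌊log₂ ((2 ℕ.^ m) ℕ.^ suc i) ⌋     ≡⟨ cong ⌊log₂_⌋ (ℕ.^-*-assoc 2 m (suc i)) ⟩
  ⌊log₂ (2 ℕ.^ (m ℕ.* suc i)) ⌋     ≡⟨ ⌊log₂[2^n]⌋≡n (m ℕ.* suc i) ⟩
  m ℕ.* suc i                       ∎)
  where open ℕ.≤-Reasoning

-- A nonempty set of naturals has a least element only up to double negation. The induction is on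
-- the bound `m`: a strategy cheaper than `c` meets a smaller bound, where the search already
-- succeeds.
opt-exists : ∀ {n} (I : Instance n) σ m c → Serves I (fromℕ (Instance.B I)) σ c →
  totalCost I (length σ) c ≤ m → ¬ ¬ (∃[ opt ] IsOPT I σ opt × opt ≤ m)
opt-exists {n} I σ = search
  where
  Offline : (ℕ → Coloring n) → Set
  Offline = Serves I (fromℕ (Instance.B I)) σ
  total : (ℕ → Coloring n) → ℕ
  total = totalCost I (length σ)
  search : ∀ m c → Offline c → total c ≤ m → ¬ ¬ (∃[ opt ] IsOPT I σ opt × opt ≤ m)
  improve : ∀ m c d → Offline d → total c ≤ m → ¬ (∃[ opt ] IsOPT I σ opt × opt ≤ m) →
            ¬ (total d ℕ.< total c)
  search m c serves c≤m none = none (total c , record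
    { attained = c , serves , refl
    ; minimal  = λ d serves′ → ℕ.≮⇒≥ (improve m c d serves′ c≤m none) } , c≤m)
  improve zero    c d serves c≤m none d<c = ℕ.n≮0 (ℕ.<-≤-trans d<c c≤m)
  improve (suc m) c d serves c≤m none d<c =
    search m d serves (ℕ.s≤s⁻¹ (ℕ.<-≤-trans d<c c≤m))
      λ (opt , isOPT , opt≤m) → none (opt , isOPT , ℕ.m≤n⇒m≤1+n opt≤m)

-- As `α` may be negative a priori, `S` cannot be enlarged to `T` under `α`; instead `0 ≤ q` lets
-- `T` be shrunk to `S` on the other side. For `S = 0` the hypothesis pushes `C` below the error one
-- half, against `1 ≤ C`.
fromℚ-≤-quotient : ∀ {q C S T} α → 0ℚ ℚ.≤ q → q ℚ.* ι T ≡ ι C → 1 ≤ C → S ≤ T →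
  fromℕ C ≤ℝ α *ℝ fromℕ S → fromℚ q ≤ℝ α
fromℚ-≤-quotient {q} {C} {zero} α 0≤q qT≡C 1≤C _ C≤αS =
  let (N , p) = C≤αS ½ (ℚ.positive⁻¹ ½)
  in ⊥-elim (1≰½ (begin
    1ℚ                              ≤⟨ ι-mono-≤ 1≤C ⟩
    ι C                             ≤⟨ p N ℕ.≤-refl ⟩
    seq α N ℚ.* 0ℚ ℚ.+ ½            ≡⟨ cong (ℚ._+ ½) (ℚ.*-zeroʳ (seq α N)) ⟩
    0ℚ ℚ.+ ½                        ≡⟨ ℚ.+-identityˡ ½ ⟩
    ½                               ∎))
  where
  open ℚ.≤-Reasoning
  1≰½ : ¬ (1ℚ ℚ.≤ ½)
  1≰½ (ℚ.*≤* (ℤ.+≤+ (s≤s ())))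
fromℚ-≤-quotient {q} {C} {suc S} {T} α 0≤q qT≡C 1≤C S≤T C≤αS e e>0 =
  let (N , p) = C≤αS e e>0 in N , λ i i≥ → bound (seq α i) (p i i≥)
  where
  open ℚ.≤-Reasoning
  open +-*-Solver
  s = ι (suc S)
  bound : ∀ a → ι C ℚ.≤ a ℚ.* s ℚ.+ e → q ℚ.≤ a ℚ.+ e
  bound a C≤ with ℚ.≤-total q a
  ... | inj₁ q≤a = ℚ.≤-trans q≤a (p≤p+q (ℚ.<⇒≤ e>0))
  ... | inj₂ a≤q = begin
    q                                        ≡⟨ solve 2 (λ q a → q := a :+ (q :+ :- a) :* con 1ℚ) refl q a ⟩
    a ℚ.+ (q ℚ.- a) ℚ.* 1ℚ
      -- Since `s` is at least 1, multiplying the nonnegative gap by it only enlarges the gap; this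
      -- replaces a division by `s`.
      ≤⟨ ℚ.+-monoʳ-≤ a (ℚ.*-monoˡ-≤-nonNeg (q ℚ.- a) {{ℚ.nonNegative 0≤q-a}} (ι-mono-≤ {1} {suc S} (s≤s z≤n))) ⟩
    a ℚ.+ (q ℚ.- a) ℚ.* s
      ≡⟨ solve 3 (λ q a s → a :+ (q :+ :- a) :* s := a :+ (q :* s :+ :- (a :* s))) refl q a s ⟩
    a ℚ.+ (q ℚ.* s ℚ.- a ℚ.* s)
      ≤⟨ ℚ.+-monoʳ-≤ a (ℚ.+-monoˡ-≤ (ℚ.- (a ℚ.* s)) qs≤) ⟩
    a ℚ.+ ((a ℚ.* s ℚ.+ e) ℚ.- a ℚ.* s)
      ≡⟨ solve 3 (λ a b e → a :+ ((b :+ e) :+ :- b) := a :+ e) refl a (a ℚ.* s) e ⟩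
    a ℚ.+ e ∎
    where
    0≤q-a : 0ℚ ℚ.≤ q ℚ.- a
    0≤q-a = subst (ℚ._≤ q ℚ.- a) (ℚ.+-inverseʳ a) (ℚ.+-monoˡ-≤ (ℚ.- a) a≤q)
    qs≤ : q ℚ.* s ℚ.≤ a ℚ.* s ℚ.+ e
    qs≤ = begin
      q ℚ.* s              ≤⟨ ℚ.*-monoˡ-≤-nonNeg q {{ℚ.nonNegative 0≤q}} (ι-mono-≤ S≤T) ⟩
      q ℚ.* ι T            ≡⟨ qT≡C ⟩
      ι C                  ≤⟨ C≤ ⟩
      a ℚ.* s ℚ.+ e        ∎

-- The constant and the choice of `k`

κ : ℚ
κ = + 1 ℚ./ 16

κ>0 : 0ℚ ℚ.< κ
κ>0 = ℚ.positive⁻¹ κ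

κ*16 : ∀ m → κ ℚ.* ι (16 ℕ.* m) ≡ ι m
κ*16 m = trans (cong (κ ℚ.*_) (ι-* 16 m))
  (trans (sym (ℚ.*-assoc κ (ι 16) (ι m))) (ℚ.*-identityˡ (ι m)))

1≤size : ∀ k → 1 ≤ size k
1≤size zero    = s≤s z≤n
1≤size (suc k) = ℕ.≤-trans (1≤size k) (ℕ.m≤m+n (size k) (size k))

size≡2^ : ∀ k → size k ≡ 2 ℕ.^ k
size≡2^ zero    = refl
size≡2^ (suc k) = cong₂ ℕ._+_ (size≡2^ k) (trans (size≡2^ k) (sym (ℕ.+-identityʳ _)))

-- The lower bound leaves room for the two mandatory extra vertices beside the `size k` pairs; the
-- upper bound gives log₂ n ≤ k + 3. When `8 * size k` is reached, `k` increases and that value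
-- becomes the new lower bound.
dyadic : ∀ d → ∃[ k ] 1 ≤ k × 4 ℕ.* size k ≤ 8 ℕ.+ d × 8 ℕ.+ d ℕ.< 8 ℕ.* size k
dyadic zero    = 1 , s≤s z≤n , ℕ.≤-refl , ℕ.m≤m+n 9 7
dyadic (suc d) with dyadic d
... | k , 1≤k , lo , hi with 8 ℕ.+ suc d ℕ.<? 8 ℕ.* size k
...   | yes hi′ = k , 1≤k , ℕ.≤-trans lo (ℕ.+-monoʳ-≤ 8 (ℕ.n≤1+n d)) , hi′
...   | no  n≮ = suc k , s≤s z≤n ,
          ℕ.≤-trans (ℕ.≤-reflexive (solve 1 (λ s → con 4 :* (s :+ s) := con 8 :* s) refl (size k))) (ℕ.≮⇒≥ n≮) ,
          (begin-strict
            8 ℕ.+ suc d                        ≡⟨ ℕ.+-suc 8 d ⟩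
            suc (8 ℕ.+ d)                      ≤⟨ hi ⟩
            8 ℕ.* size k                       <⟨ ℕ.m<m+n (8 ℕ.* size k) (ℕ.≤-trans (1≤size k) (ℕ.m≤m+n (size k) _)) ⟩
            8 ℕ.* size k ℕ.+ 8 ℕ.* size k      ≡⟨ sym (ℕ.*-distribˡ-+ 8 (size k) (size k)) ⟩
            8 ℕ.* size (suc k)                 ∎)
  where open ℕ-Solver
        open ℕ.≤-Reasoning

decompose : ∀ n → 8 ≤ n →
  ∃[ k ] ∃[ r ] 1 ≤ k × n ≡ size k ℕ.+ (size k ℕ.+ suc (suc r)) × n ≤ 2 ℕ.^ (k ℕ.+ 3)
decompose n 8≤n = go (dyadic (n ℕ.∸ 8))
  where
  open ℕ.≤-Reasoning
  8+[n∸8] : 8 ℕ.+ (n ℕ.∸ 8) ≡ n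
  8+[n∸8] = ℕ.m+[n∸m]≡n 8≤n
  padding : ∀ s → 1 ≤ s → s ℕ.+ (s ℕ.+ 2) ≤ 4 ℕ.* s
  padding s 1≤s = ℕ.+-monoʳ-≤ s (ℕ.+-monoʳ-≤ s (ℕ.+-mono-≤ 1≤s
    (subst (1 ≤_) (sym (ℕ.+-identityʳ s)) 1≤s)))
  go : _ → ∃[ k ] ∃[ r ] 1 ≤ k × n ≡ size k ℕ.+ (size k ℕ.+ suc (suc r)) × n ≤ 2 ℕ.^ (k ℕ.+ 3)
  go (k , 1≤k , lo , hi) = k , r , 1≤k , split , (begin
    n                       ≡⟨ sym 8+[n∸8] ⟩
    8 ℕ.+ (n ℕ.∸ 8)         ≤⟨ ℕ.<⇒≤ hi ⟩
    8 ℕ.* size k            ≡⟨ ℕ.*-comm 8 (size k) ⟩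
    size k ℕ.* 8            ≡⟨ cong (ℕ._* 8) (size≡2^ k) ⟩
    2 ℕ.^ k ℕ.* 2 ℕ.^ 3     ≡⟨ sym (ℕ.^-distribˡ-+-* 2 k 3) ⟩
    2 ℕ.^ (k ℕ.+ 3)         ∎)
    where
    m = size k ℕ.+ (size k ℕ.+ 2)
    r = n ℕ.∸ m
    m≤n : m ≤ n
    m≤n = ℕ.≤-trans (padding (size k) (1≤size k)) (subst (4 ℕ.* size k ≤_) 8+[n∸8] lo)
    split : n ≡ size k ℕ.+ (size k ℕ.+ (2 ℕ.+ r))
    split = begin-equality
      n                                    ≡⟨ sym (ℕ.m+[n∸m]≡n m≤n) ⟩
      size k ℕ.+ (size k ℕ.+ 2) ℕ.+ r      ≡⟨ ℕ.+-assoc (size k) (size k ℕ.+ 2) r ⟩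
      size k ℕ.+ ((size k ℕ.+ 2) ℕ.+ r)    ≡⟨ cong (size k ℕ.+_) (ℕ.+-assoc (size k) 2 r) ⟩
      size k ℕ.+ (size k ℕ.+ (2 ℕ.+ r))    ∎

-- Averaging the competitive inequality over all outcomes

module LowerBound (k r : ℕ) (1≤k : 1 ≤ k) where
  open Construction (size k) r public

  requests : List (Request V)
  requests = block k id

  requests-hard : Game.Hard inst [] requests
  requests-hard = block-hard k (λ _ → ℕ.≤-refl) []

  outcome-coloring : ∀ {τ} → Outcome requests τ → ∃[ x ] Proper τ (coloring x)
  outcome-coloring o = let (y , proper) = block-solvable k o in y , proper false y (λ _ → refl)

  outcome-admissible : ∀ {τ} → Outcome requests τ → Admissible inst τ
  outcome-admissible o = let (x , p) = outcome-coloring o in coloring x , p , coloring-within x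

  outcome-opt : ∀ {τ} → Outcome requests τ → ¬ ¬ (∃[ opt ] IsOPT inst τ opt × opt ≤ size k ℕ.+ size k)
  outcome-opt {τ} o = let (x , p) = outcome-coloring o in
    opt-exists inst τ (size k ℕ.+ size k) (offline x) (offline-serves x p) (offline-cost x (length τ))

  module _ {ε : ℝ} (𝒜 : RandomizedAlgorithm inst ε) (α : ℝ)
           (competitive : CompetitiveWith inst 𝒜 α) where
    open RandomizedAlgorithm 𝒜
    open Probability distribution

    ∑cost : List (List (Edge V)) → ℝ
    ∑cost = ∑𝔼 (λ σ → cost inst σ) cost-measurable
              (λ σ → length σ ℕ.* Instance.totalWeight inst) (λ σ → cost-bound inst σ)

    -- `S` is the sum of the actual optima. It stays under `α` unreplaced because multiplication by
    -- `α` is not known to be monotone.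
    ∑cost-upper : ∀ {σs} → All (Outcome requests) σs →
      ¬ ¬ (∃[ S ] S ≤ length σs ℕ.* (size k ℕ.+ size k) × ∑cost σs ≤ℝ α *ℝ fromℕ S)
    ∑cost-upper []                none = none (0 , z≤n ,
      pointwise-≡ {0ℝ} {α *ℝ fromℕ 0} (λ i → sym (ℚ.*-zeroʳ (seq α i))))
    ∑cost-upper {σ ∷ σs} (o ∷ os) none = outcome-opt o λ (opt , isOPT , opt≤) →
      ∑cost-upper os λ (S , S≤ , cost≤) →
      none (opt ℕ.+ S , ℕ.+-mono-≤ opt≤ S≤ ,
        ≤ℝ-trans {∑cost (σ ∷ σs)} {α *ℝ fromℕ opt +ℝ α *ℝ fromℕ S} {α *ℝ fromℕ (opt ℕ.+ S)}
          (+ℝ-mono-≤ {expectedCost σ} {α *ℝ fromℕ opt} {∑cost σs} {α *ℝ fromℕ S}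
            (competitive σ (outcome-admissible o) opt isOPT) cost≤)
          (pointwise-≡ {α *ℝ fromℕ opt +ℝ α *ℝ fromℕ S} {α *ℝ fromℕ (opt ℕ.+ S)}
            (λ i → trans (sym (ℚ.*-distribˡ-+ (seq α i) (ι opt) (ι S)))
              (cong (seq α i ℚ.*_) (sym (ι-+ opt S))))))

    C U : ℕ
    C = 2 ℕ.^ length requests ℕ.* gain requests
    U = length (outcomes requests) ℕ.* (size k ℕ.+ size k)

    ∑cost-lower : fromℕ C ≤ℝ ∑cost (outcomes requests)
    ∑cost-lower = ∑𝔼-lower (λ σ → cost inst σ) cost-measurable
      (λ σ → length σ ℕ.* Instance.totalWeight inst) (λ σ → cost-bound inst σ)
      (outcomes requests) C
      (λ A → Game.outcomes-cost inst A [] requests requests-hard (λ τ o → outcome-admissible o))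

    -- Says C / U = k / 4 without division: per outcome the online cost averages at least half of
    -- `k * size k`, against an optimum of at most twice `size k`.
    4kU≡16C : 4 ℕ.* k ℕ.* U ≡ 16 ℕ.* C
    4kU≡16C = trans (cong (λ z → 4 ℕ.* k ℕ.* (z ℕ.* (size k ℕ.+ size k))) (length-outcomes requests))
      (trans (solve 3 (λ k p s → con 4 :* k :* (p :* (s :+ s)) := con 8 :* p :* (k :* s)) refl k p (size k))
        (trans (cong (8 ℕ.* p ℕ.*_) (sym (block-gain k id)))
          (solve 2 (λ p g → con 8 :* p :* (con 2 :* g) := con 16 :* (p :* g)) refl p (gain requests))))
      where
      open ℕ-Solver
      p = 2 ℕ.^ length requests

    1≤C : 1 ≤ C
    1≤C = ℕ.*-mono-≤ (ℕ.m^n>0 2 (length requests)) (gain≥1 (gain requests)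
      (subst (1 ≤_) (sym (block-gain k id)) (ℕ.*-mono-≤ 1≤k (1≤size k))))
      where
      gain≥1 : ∀ g → 1 ≤ 2 ℕ.* g → 1 ≤ g
      gain≥1 (suc g) _ = s≤s z≤n

    -- The double negation from the optima is discharged here, since the goal is a stable inequality
    -- of reals.
    κ*4k≤α : fromℚ (κ ℚ.* ι (4 ℕ.* k)) ≤ℝ α
    κ*4k≤α = ≤ℝ-stable {fromℚ (κ ℚ.* ι (4 ℕ.* k))} {α} λ κ*4k≰α →
      ∑cost-upper (outcomes-sound requests) λ (S , S≤U , cost≤) →
      κ*4k≰α (fromℚ-≤-quotient {κ ℚ.* ι (4 ℕ.* k)} {C} {S} {U} α
        (subst (ℚ._≤ κ ℚ.* ι (4 ℕ.* k)) (ℚ.*-zeroʳ κ) (ℚ.*-monoˡ-≤-nonNeg κ (0≤ι (4 ℕ.* k))))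
        (trans (ℚ.*-assoc κ (ι (4 ℕ.* k)) (ι U))
          (trans (cong (κ ℚ.*_) (trans (sym (ι-* (4 ℕ.* k) U)) (cong ι 4kU≡16C))) (κ*16 C)))
        1≤C S≤U
        (≤ℝ-trans {fromℕ C} {∑cost (outcomes requests)} {α *ℝ fromℕ S} ∑cost-lower cost≤))

theorem4 : Σ[ κ ∈ ℝ ] (0ℝ <ℝ κ) × (∃[ n₀ ]
    (∀ (n : ℕ) .{{_ : NonZero n}} → n₀ ≤ n →
    ∀ (ε : ℝ) → 0ℝ <ℝ ε →
    Σ[ I ∈ Instance n ]
    (∀ (𝒜 : RandomizedAlgorithm I ε) (α : ℝ) →
    CompetitiveWith I 𝒜 α → κ *ℝ log₂ n ≤ℝ α)))
-- The threshold 8 is `4 * size 1`, the least n for which `dyadic` yields `k ≥ 1`; this makes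
-- `k + 3 ≤ 4 * k` and the total gain positive.
theorem4 = fromℚ κ , (κ , κ>0 , 0 , λ _ _ → ℚ.≤-reflexive (ℚ.+-identityˡ κ)) , 8 , bound
  where
  k+3≤4k : ∀ k → 1 ≤ k → k ℕ.+ 3 ≤ 4 ℕ.* k
  k+3≤4k k 1≤k = ℕ.+-monoʳ-≤ k (ℕ.*-monoʳ-≤ 3 1≤k)
  bound : ∀ n .{{_ : NonZero n}} → 8 ≤ n → ∀ ε → 0ℝ <ℝ ε →
    Σ[ I ∈ Instance n ] (∀ (𝒜 : RandomizedAlgorithm I ε) α →
      CompetitiveWith I 𝒜 α → fromℚ κ *ℝ log₂ n ≤ℝ α)
  bound n 8≤n ε _ with decompose n 8≤n
  ... | k , r , 1≤k , refl , n≤2^ = inst , λ 𝒜 α competitive →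
    ≤ℝ-trans {fromℚ κ *ℝ log₂ V} {fromℚ (κ ℚ.* ι (4 ℕ.* k))} {α}
      (pointwise-≤ {fromℚ κ *ℝ log₂ V} {fromℚ (κ ℚ.* ι (4 ℕ.* k))} λ i →
        ℚ.*-monoˡ-≤-nonNeg κ (ℚ.≤-trans (log₂-seq-≤ V (k ℕ.+ 3) n≤2^ i) (ι-mono-≤ (k+3≤4k k 1≤k))))
      (κ*4k≤α 𝒜 α competitive)
    where open LowerBound k r 1≤k
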